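{- Let $G$ be a graph. The following are equivalent: (1) $G$ has linear rank-width at most $1$; (2) $G$ has no vertex-minor isomorphic to $C_5$, $N$ or $Q$; (3) $G$ is a vertex-minor of a path.
   Context: All graphs are finite, simple and undirected. $C_5$ is the cycle on $5$ vertices; $N$ is the graph on $6$ vertices consisting of a triangle together with one pendant vertex attached to each vertex of the triangle; $Q$ is the graph on $6$ vertices consisting of a $4$-cycle $p_1p_2p_3p_4$ together with two pendant vertices, one adjacent to $p_1$ and one adjacent to $p_3$. Local complementation at $v$ in $G=(V,E)$ gives $G*v=(V,E\,\Delta\,\{xy:xv,yv\in E,x\ne y\})$; a vertex-minor of $G$ is a graph obtained by a sequence of vertex deletions and local complementations. Linear rank-width: with $A(G)$ the adjacency matrix over $GF(2)$, the cut-rank of $X\subseteq V(G)$ is the rank of the submatrix of $A(G)$ with rows $X$ and columns $V(G)\setminus X$; a subcubic tree is a tree with at least two vertices in which every non-leaf vertex has degree $3$; a caterpillar is a tree containing a path $P$ with every vertex at distance at most $1$ from $P$; a linear rank-decomposition is a pair $(T,L)$ with $T$ a subcubic caterpillar and $L$ a bijection from $V(G)$ to the leaves of $T$, an edge $e$ of $T$ having width equal to the cut-rank of $L^{ -1}(X_e)$ where $X_e$ is the leaf set of a component of $T\setminus e$; the linear rank-width of $G$ is the minimum over linear rank-decompositions of the maximum edge width, and is $0$ if $|V(G)|\le 1$. -}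

module Defs where

open import Data.Nat using (ℕ; zero; suc; _+_; _≤_; _<_; _≡ᵇ_; _<ᵇ_)
open import Data.Bool using (Bool; true; false; _∧_; _∨_; _xor_; not; if_then_else_)
open import Data.Bool.Properties using (∨-comm; ∧-comm)
open import Data.Fin using (Fin; zero; suc; toℕ; punchIn; #_)
open import Data.Fin.Properties using (toℕ-injective)
open import Data.Product using (Σ; ∃; ∃-syntax; _×_; _,_)
open import Data.Sum using (_⊎_)
open import Data.List using (List; []; _∷_)
open import Data.Bool.ListAction using (any)
open import Function using (_∘_)

open import Function.Bundles using (_↔_; Inverse)
open import Relation.Binary.PropositionalEquality using (_≡_; refl; cong; cong₂; sym; trans)

record Graph (n : ℕ) : Set where
  field
    adj    : Fin n → Fin n → Bool
    adj-sym    : ∀ i j → adj i j ≡ adj j i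
    adj-irrefl : ∀ i → adj i i ≡ false
open Graph public

_=ᶠ_ : ∀ {n} → Fin n → Fin n → Bool
i =ᶠ j = toℕ i ≡ᵇ toℕ j

=ᶠ-refl : ∀ {n} (i : Fin n) → (i =ᶠ i) ≡ true
=ᶠ-refl i = ≡ᵇ-refl (toℕ i)
  where
  ≡ᵇ-refl : ∀ a → (a ≡ᵇ a) ≡ true
  ≡ᵇ-refl zero = refl
  ≡ᵇ-refl (suc a) = ≡ᵇ-refl a

≡ᵇ-sym : ∀ a b → (a ≡ᵇ b) ≡ (b ≡ᵇ a)
≡ᵇ-sym zero zero = refl
≡ᵇ-sym zero (suc b) = refl
≡ᵇ-sym (suc a) zero = refl
≡ᵇ-sym (suc a) (suc b) = ≡ᵇ-sym a b

=ᶠ-sym : ∀ {n} (i j : Fin n) → (i =ᶠ j) ≡ (j =ᶠ i)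
=ᶠ-sym i j = ≡ᵇ-sym (toℕ i) (toℕ j)

delete : ∀ {n} → Graph (suc n) → Fin (suc n) → Graph n
delete G v = record
  { adj        = λ i j → adj G (punchIn v i) (punchIn v j)
  ; adj-sym    = λ i j → adj-sym G (punchIn v i) (punchIn v j)
  ; adj-irrefl = λ i → adj-irrefl G (punchIn v i) }

xor-false : ∀ b → (b xor false) ≡ b
xor-false true = refl
xor-false false = refl

lc-sym : ∀ a b c d e → a ≡ b → (a xor (c ∧ d ∧ not e)) ≡ (b xor (d ∧ c ∧ not e))
lc-sym a .a true true e refl = refl
lc-sym a .a true false e refl = refl
lc-sym a .a false true e refl = refl
lc-sym a .a false false e refl = refl

lc-irr : ∀ a c → a ≡ false → (a xor (c ∧ c ∧ not true)) ≡ false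
lc-irr .false true refl = refl
lc-irr .false false refl = refl

_*_ : ∀ {n} → Graph n → Fin n → Graph n
G * v = record
  { adj        = λ x y → adj G x y xor (adj G x v ∧ adj G y v ∧ not (x =ᶠ y))
  ; adj-sym    = λ x y → trans (lc-sym (adj G x y) (adj G y x) (adj G x v) (adj G y v) (x =ᶠ y) (adj-sym G x y))
                           (cong (λ e → adj G y x xor (adj G y v ∧ adj G x v ∧ not e)) (=ᶠ-sym x y))
  ; adj-irrefl = λ x → trans (cong (λ e → adj G x x xor (adj G x v ∧ adj G x v ∧ not e)) (=ᶠ-refl x))
                         (lc-irr (adj G x x) (adj G x v) (adj-irrefl G x)) }

data Reach : ∀ {m n} → Graph m → Graph n → Set where
  done : ∀ {m} {G : Graph m} → Reach G G
  del  : ∀ {m n} {G : Graph (suc m)} {H : Graph n} (v : Fin (suc m)) →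
         Reach (delete G v) H → Reach G H
  loc  : ∀ {m n} {G : Graph m} {H : Graph n} (v : Fin m) →
         Reach (G * v) H → Reach G H

_≅_ : ∀ {m n} → Graph m → Graph n → Set
_≅_ {m} {n} G H = Σ (Fin m ↔ Fin n) λ f →
  ∀ i j → adj G i j ≡ adj H (Inverse.to f i) (Inverse.to f j)

HasVertexMinor : ∀ {m n} → Graph m → Graph n → Set
HasVertexMinor {m} G H = ∃[ k ] Σ (Graph k) λ K → Reach G K × (K ≅ H)

edgeIn : ∀ {n} → Fin n → Fin n → List (Fin n × Fin n) → Bool
edgeIn i j = any (λ { (a , b) → (i =ᶠ a) ∧ (j =ᶠ b) })

fromEdges : ∀ {n} → List (Fin n × Fin n) → Graph n
fromEdges es = record
  { adj        = λ i j → (edgeIn i j es ∨ edgeIn j i es) ∧ not (i =ᶠ j)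
  ; adj-sym    = λ i j → cong₂ (λ p q → p ∧ not q) (∨-comm (edgeIn i j es) (edgeIn j i es)) (=ᶠ-sym i j)
  ; adj-irrefl = λ i → trans (cong (λ q → (edgeIn i i es ∨ edgeIn i i es) ∧ not q) (=ᶠ-refl i))
                         (∧-comm _ false) }

C5 : Graph 5
C5 = fromEdges ((# 0 , # 1) ∷ (# 1 , # 2) ∷ (# 2 , # 3) ∷ (# 3 , # 4) ∷ (# 4 , # 0) ∷ [])

N : Graph 6
N = fromEdges ((# 0 , # 1) ∷ (# 1 , # 2) ∷ (# 2 , # 0) ∷ (# 0 , # 3) ∷ (# 1 , # 4) ∷ (# 2 , # 5) ∷ [])

Q : Graph 6
Q = fromEdges ((# 0 , # 1) ∷ (# 1 , # 2) ∷ (# 2 , # 3) ∷ (# 3 , # 0) ∷ (# 0 , # 4) ∷ (# 2 , # 5) ∷ [])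

pathAdj : ∀ {k} → Fin k → Fin k → Bool
pathAdj i j = (suc (toℕ i) ≡ᵇ toℕ j) ∨ (suc (toℕ j) ≡ᵇ toℕ i)

sucᵇ-irr : ∀ a → (suc a ≡ᵇ a) ≡ false
sucᵇ-irr zero = refl
sucᵇ-irr (suc a) = sucᵇ-irr a

Path : (k : ℕ) → Graph k
Path k = record
  { adj        = pathAdj
  ; adj-sym    = λ i j → ∨-comm (suc (toℕ i) ≡ᵇ toℕ j) (suc (toℕ j) ≡ᵇ toℕ i)
  ; adj-irrefl = λ i → cong₂ _∨_ (sucᵇ-irr (toℕ i)) (sucᵇ-irr (toℕ i)) }

count : ∀ {n} → (Fin n → Bool) → ℕ
count {zero}  f = 0
count {suc n} f = (if f zero then 1 else 0) + count (f ∘ suc)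

parity : ∀ {n} → (Fin n → Bool) → Bool
parity {zero}  f = false
parity {suc n} f = f zero xor parity (f ∘ suc)

_⊆ᵇ_ : ∀ {n} → (Fin n → Bool) → (Fin n → Bool) → Set
S ⊆ᵇ X = ∀ x → S x ≡ true → X x ≡ true

-- S ⊆ X indexes a linearly independent (over GF(2)) family of rows of the
-- submatrix A(G)[X, V∖X]: every nonempty subfamily sums to a nonzero vector.
IndependentRows : ∀ {n} → Graph n → (Fin n → Bool) → (Fin n → Bool) → Set
IndependentRows {n} G X S =
  S ⊆ᵇ X ×
  (∀ (T : Fin n → Bool) → T ⊆ᵇ S → (∃[ x ] T x ≡ true) →
     ∃[ y ] (X y ≡ false × parity (λ x → T x ∧ adj G x y) ≡ true))

-- cut-rank of X is at most k  (rank = maximum number of independent rows)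
CutRank≤ : ∀ {n} → Graph n → (Fin n → Bool) → ℕ → Set
CutRank≤ {n} G X k = ∀ (S : Fin n → Bool) → IndependentRows G X S → count S ≤ k

-- Linear rank-decompositions.
-- A subcubic caterpillar with n ≥ 2 leaves, with a bijection to V(G), is
-- determined by the order σ(0), ..., σ(n-1) in which the leaves occur along
-- the spine.  Its edges are the pendant leaf edges (one side: a single
-- leaf {σ(i)}) and the spine edges (one side: the first j leaves,
-- 1 ≤ j ≤ n-1).  (For n = 2 the tree is a single edge, side {σ(0)}.)

singletonSet : ∀ {n} → Fin n → (Fin n → Bool)
singletonSet v x = x =ᶠ v

prefixSet : ∀ {n} → (Fin n ↔ Fin n) → ℕ → (Fin n → Bool)
prefixSet σ j x = toℕ (Inverse.from σ x) <ᵇ j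


DecompWidth≤ : ∀ {n} → Graph n → (Fin n ↔ Fin n) → ℕ → Set
DecompWidth≤ {n} G σ k =
  (∀ v → CutRank≤ G (singletonSet v) k) ×
  (∀ j → 1 ≤ j → j < n → CutRank≤ G (prefixSet σ j) k)

-- linear rank-width at most k (it is 0 when |V(G)| ≤ 1)
LinRankWidth≤ : ∀ {n} → Graph n → ℕ → Set
LinRankWidth≤ {n} G k = n ≤ 1 ⊎ (2 ≤ n × Σ (Fin n ↔ Fin n) λ σ → DecompWidth≤ G σ k)

{-# OPTIONS --safe #-}

-- (1) ⇒ (2), (3) ⇒ (2): having an ordering all of whose prefixes have cut-rank at most 1 is invariant under local
-- complementation (row and column operations) and inherited by induced subgraphs; paths have such an ordering, whereas every
-- 2-subset of C5 and every 3-subset of N and Q has cut-rank at least 2.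
--
-- (2) ⇒ (1): order the vertices of G minus v inductively. Read along this ordering, and up to local complementation, G minus v
-- is a caterpillar. Either two vertices of G are twins, pendant or isolated, or v is adjacent to both ends of a path on at
-- least four vertices, which yields C5. In the former case let x be pendant at a, after local complementation, and let
-- P, a, R be an ordering of G minus x. If x cannot be inserted next to a, there is an edge p r from P to R and p, a, r may be
-- assumed to form a triangle. Either the neighbours of a in P (or those in R) form a clique without further neighbours there,
-- so that a and x can be moved past them, or p and r have partners p′ and r′ and the six vertices p, a, r, p′, x, r′
-- yield N or Q.
--
-- (2) ⇒ (3): along the ordering, G is realized inside a path one vertex at a time. Up to local complementation the next vertex
-- is pendant at the last one (the path is extended) or isolated. Local complementation at the last vertex t, at position e of
-- the path, is simulated by complementing at e and letting e + 1 represent t.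
module Submission where

open import Defs
open import Data.Bool using (Bool; T; true; false; _∧_; _∨_; _xor_; not; if_then_else_)
import Data.Bool.Properties as Bool
open import Data.Empty using (⊥; ⊥-elim)
open import Data.Fin using (Fin; zero; suc; toℕ; fromℕ<; punchIn; punchOut; #_)
import Data.Fin as Fin
import Data.Fin.Properties as Fin
open import Data.List using (List; []; _∷_; _++_; _ʳ++_; reverse; length; foldl; map; allFin; lookup; take; drop)
import Data.List.Properties as List
open import Data.List.Membership.Propositional using (_∈_; _∉_)
open import Data.List.Membership.Propositional.Properties using (∈-++⁺ˡ; ∈-++⁺ʳ; ∈-++⁻; ∈-∃++; ∈-allFin; ∈-lookup; ∈-insert)
open import Data.List.Relation.Binary.Permutation.Propositional using (_↭_; ↭-refl; ↭-sym; ↭-trans; ↭-reflexive; ↭⇒↭ₛ; prep; swap; module PermutationReasoning)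
import Data.List.Relation.Binary.Permutation.Propositional.Properties as Perm
import Data.List.Relation.Binary.Permutation.Setoid.Properties as SetoidPerm
open import Data.List.Relation.Binary.Sublist.Propositional using (_⊆_; _∷ʳ_; ⊆-refl) renaming (lookup to ⊆-lookup)
import Data.List.Relation.Binary.Sublist.Propositional as Sublist
import Data.List.Relation.Binary.Sublist.Propositional.Properties as Sublist
open import Data.List.Relation.Unary.All using (All; []; _∷_)
import Data.List.Relation.Unary.All as All
import Data.List.Relation.Unary.All.Properties as All
import Data.List.Relation.Unary.AllPairs as AllPairs
open import Data.List.Relation.Unary.AllPairs using ([]; _∷_)
open import Data.List.Relation.Unary.Any using (Any; here; there; index)
import Data.List.Relation.Unary.Any.Properties as Any
open import Data.List.Relation.Unary.Unique.Propositional using (Unique)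
import Data.List.Relation.Unary.Unique.Propositional.Properties as Unique
open import Data.Nat using (ℕ; zero; suc; _+_; _≤_; _<_; _≡ᵇ_; _<ᵇ_; z≤n; s≤s)
import Data.Nat.Properties as ℕ
open import Data.Product using (∃; ∃₂; ∃-syntax; _×_; _,_; proj₁; proj₂)
open import Data.Sum using (_⊎_; inj₁; inj₂; [_,_]′)
open import Data.Unit using (⊤; tt)
open import Data.Vec using (Vec; []; _∷_)
import Data.Vec as Vec
import Data.Vec.Properties as Vec
open import Function using (_∘_; id; flip; case_of_)
open import Function.Bundles using (_⇔_; mk⇔; _↔_; mk↔ₛ′; Inverse)
open import Relation.Binary.PropositionalEquality using (_≡_; _≢_; refl; sym; trans; cong; cong₂; subst; setoid; module ≡-Reasoning)
open import Relation.Nullary using (¬_; Dec; yes; no; contradiction; ¬?)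
open import Relation.Nullary.Decidable using (from-yes; _→-dec_; _×-dec_; _⊎-dec_)

private variable
  k m n : ℕ

-- Boolean identities and local complementation

-- Boolean identities are proved below by running through the truth table; `from-yes` extracts the
-- proof from the decision.
∀? : {P : Bool → Set} → (∀ b → Dec (P b)) → Dec (∀ b → P b)
∀? P? with P? true | P? false
... | yes p | yes q = yes λ { true → p ; false → q }
... | no ¬p | _     = no λ f → ¬p (f true)
... | _     | no ¬q = no λ f → ¬q (f false)

dichotomy : ∀ b → b ≡ true ⊎ b ≡ false
dichotomy true  = inj₁ refl
dichotomy false = inj₂ refl

∧-true : ∀ {a b} → a ∧ b ≡ true → a ≡ true × b ≡ true
∧-true {true} {true} _ = refl , refl

true≢false : ∀ {b} → b ≡ true → b ≡ false → ⊥
true≢false refl ()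

=ᶠ-≢ : {x y : Fin n} → x ≢ y → (x =ᶠ y) ≡ false
=ᶠ-≢ {x = x} {y} x≢y with dichotomy (x =ᶠ y)
... | inj₂ e = e
... | inj₁ e = contradiction (Fin.toℕ-injective (ℕ.≡ᵇ⇒≡ (toℕ x) (toℕ y) (subst T (sym e) tt))) x≢y

adj-≢ : (G : Graph n) {x y : Fin n} → adj G x y ≡ true → x ≢ y
adj-≢ G {x} e refl = true≢false e (adj-irrefl G x)

module _ (G : Graph n) (w : Fin n) where

  lc-off : ∀ {x y} → x ≢ y → adj (G * w) x y ≡ adj G x y xor (adj G x w ∧ adj G y w)
  lc-off {x} {y} x≢y = cong (adj G x y xor_) (cong (adj G x w ∧_)
    (trans (cong (λ b → adj G y w ∧ not b) (=ᶠ-≢ x≢y)) (Bool.∧-identityʳ _)))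

  lc-skipˡ : ∀ {x y} → adj G x w ≡ false → adj (G * w) x y ≡ adj G x y
  lc-skipˡ {x} {y} e = trans (cong (λ b → adj G x y xor (b ∧ adj G y w ∧ not (x =ᶠ y))) e) (Bool.xor-identityʳ _)

  lc-skipʳ : ∀ {x y} → adj G y w ≡ false → adj (G * w) x y ≡ adj G x y
  lc-skipʳ {x} {y} e = trans (adj-sym (G * w) x y) (trans (lc-skipˡ e) (adj-sym G y x))

  lc-centreʳ : ∀ x → adj (G * w) x w ≡ adj G x w
  lc-centreʳ x = lc-skipʳ (adj-irrefl G w)

  lc-centreˡ : ∀ y → adj (G * w) w y ≡ adj G w y
  lc-centreˡ y = lc-skipˡ (adj-irrefl G w)

  lc-toggle : ∀ {x y} → x ≢ y → adj G x w ≡ true → adj G y w ≡ true → adj (G * w) x y ≡ not (adj G x y)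
  lc-toggle {x} {y} x≢y p q = trans (lc-off x≢y)
    (trans (cong₂ (λ a b → adj G x y xor (a ∧ b)) p q) (Bool.xor-comm (adj G x y) true))

xor-cancelʳ : ∀ a b → (a xor b) xor b ≡ a
xor-cancelʳ a b = trans (Bool.xor-assoc a b b) (trans (cong (a xor_) (Bool.xor-same b)) (Bool.xor-identityʳ a))

-- The neighbourhood of `w` is the same in `G` and `G * w`, so the second complementation toggles
-- the same pairs as the first.
lc-involutive : (G : Graph n) (w : Fin n) → ∀ x y → adj ((G * w) * w) x y ≡ adj G x y
lc-involutive G w x y = trans
  (cong₂ (λ a b → adj (G * w) x y xor (a ∧ b ∧ not (x =ᶠ y))) (lc-centreʳ G w x) (lc-centreʳ G w y))
  (xor-cancelʳ (adj G x y) _)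

-- Rank at most 1, expressed by the vanishing of the 2 × 2 minors of the S × T block of the adjacency matrix.
Cut : Graph n → (Fin n → Set) → (Fin n → Set) → Set
Cut G S T = ∀ {x x′ y y′} → S x → S x′ → T y → T y′ → adj G x y ∧ adj G x′ y′ ≡ adj G x y′ ∧ adj G x′ y

Cut-sym : (G : Graph n) {S T : Fin n → Set} → Cut G S T → Cut G T S
Cut-sym G c {y} {y′} {x} {x′} sy sy′ sx sx′ = begin
  adj G y x ∧ adj G y′ x′  ≡⟨ cong₂ _∧_ (adj-sym G y x) (adj-sym G y′ x′) ⟩
  adj G x y ∧ adj G x′ y′  ≡⟨ c sx sx′ sy sy′ ⟩
  adj G x y′ ∧ adj G x′ y  ≡⟨ Bool.∧-comm (adj G x y′) (adj G x′ y) ⟩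
  adj G x′ y ∧ adj G x y′  ≡⟨ cong₂ _∧_ (adj-sym G x′ y) (adj-sym G x y′) ⟩
  adj G y x′ ∧ adj G y′ x  ∎
  where open ≡-Reasoning

Cut-cong : {G H : Graph n} {S T : Fin n → Set} → (∀ x y → adj G x y ≡ adj H x y) → Cut G S T → Cut H S T
Cut-cong e c {x} {x′} {y} {y′} sx sx′ ty ty′ =
  trans (sym (cong₂ _∧_ (e x y) (e x′ y′))) (trans (c sx sx′ ty ty′) (cong₂ _∧_ (e x y′) (e x′ y)))

Dominated : Graph n → (S T : Fin n → Set) → Fin n → Set
Dominated G S T x =
  (∀ {y} → T y → adj G x y ≡ false) ⊎ ∃ λ a → S a × (∀ {y} → T y → adj G x y ≡ adj G a y)

-- Rows that are zero or repeat a row of `S` cannot raise the rank: each minor is trivially zero or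
-- equals one of the `S` × `T` block.
Cut-dominated : (G : Graph n) {S S′ T : Fin n → Set} → Cut G S T → (∀ {x} → S′ x → Dominated G S T x) → Cut G S′ T
Cut-dominated G c d {x} {x′} {y} {y′} sx sx′ ty ty′ with d sx | d sx′
... | inj₁ z | _ rewrite z ty | z ty′ = refl
... | inj₂ _ | inj₁ z rewrite z ty | z ty′ = trans (Bool.∧-zeroʳ _) (sym (Bool.∧-zeroʳ _))
... | inj₂ (a , sa , e) | inj₂ (a′ , sa′ , e′) rewrite e ty | e ty′ | e′ ty | e′ ty′ = c sa sa′ ty ty′

Cut-⊆ˡ : (G : Graph n) {S S′ T : Fin n → Set} → (∀ {x} → S′ x → S x) → Cut G S T → Cut G S′ T
Cut-⊆ˡ G i c sx sx′ = c (i sx) (i sx′)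

Cut-⊆ʳ : (G : Graph n) {S T T′ : Fin n → Set} → (∀ {x} → T′ x → T x) → Cut G S T → Cut G S T′
Cut-⊆ʳ G i c sx sx′ ty ty′ = c sx sx′ (i ty) (i ty′)

-- Over GF(2) the hypothesis says that every row is a scalar multiple of row `a`; the vertex `a`
-- itself may lie outside `S`.
Cut-multiples : (G : Graph n) {S T : Fin n → Set} (a : Fin n) →
  (∀ {x} → S x → (∀ {y} → T y → adj G x y ≡ false) ⊎ (∀ {y} → T y → adj G x y ≡ adj G a y)) → Cut G S T
Cut-multiples {n} G {S} {T} a m = Cut-dominated G {S = _≡ a} (λ { {y = y} refl refl _ _ → Bool.∧-comm (adj G a y) _ })
  (λ sx → dom (m sx))
  where
  dom : ∀ {x} → (∀ {y} → T y → adj G x y ≡ false) ⊎ (∀ {y} → T y → adj G x y ≡ adj G a y) → Dominated G (_≡ a) T x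
  dom (inj₁ z) = inj₁ z
  dom (inj₂ e) = inj₂ (a , refl , e)

-- Minors are multilinear in the rows x, x′, and local complementation at w adds multiples of row w.
row-addition : ∀ a b c d e f α β → a ∧ d ≡ b ∧ c → a ∧ f ≡ b ∧ e → c ∧ f ≡ d ∧ e →
  (a xor (α ∧ e)) ∧ (d xor (β ∧ f)) ≡ (b xor (α ∧ f)) ∧ (c xor (β ∧ e))
row-addition = from-yes (∀? λ a → ∀? λ b → ∀? λ c → ∀? λ d → ∀? λ e → ∀? λ f → ∀? λ α → ∀? λ β →
  (a ∧ d Bool.≟ b ∧ c) →-dec (a ∧ f Bool.≟ b ∧ e) →-dec (c ∧ f Bool.≟ d ∧ e) →-dec
  ((a xor (α ∧ e)) ∧ (d xor (β ∧ f)) Bool.≟ (b xor (α ∧ f)) ∧ (c xor (β ∧ e))))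

Cut-lcˡ : (G : Graph n) {S T : Fin n → Set} {w : Fin n} → (∀ {x} → S x → T x → ⊥) → S w → Cut G S T → Cut (G * w) S T
Cut-lcˡ G {w = w} disj sw c {x} {x′} {y} {y′} sx sx′ ty ty′ = begin
  adj (G * w) x y ∧ adj (G * w) x′ y′
    ≡⟨ cong₂ _∧_ (lc sx ty) (lc sx′ ty′) ⟩
  (adj G x y xor (adj G x w ∧ adj G w y)) ∧ (adj G x′ y′ xor (adj G x′ w ∧ adj G w y′))
    ≡⟨ row-addition (adj G x y) (adj G x y′) (adj G x′ y) (adj G x′ y′) (adj G w y) (adj G w y′) (adj G x w) (adj G x′ w)
         (c sx sx′ ty ty′) (c sx sw ty ty′) (trans (c sx′ sw ty ty′) refl) ⟩
  (adj G x y′ xor (adj G x w ∧ adj G w y′)) ∧ (adj G x′ y xor (adj G x′ w ∧ adj G w y))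
    ≡⟨ cong₂ _∧_ (lc sx ty′) (lc sx′ ty) ⟨
  adj (G * w) x y′ ∧ adj (G * w) x′ y ∎
  where
  open ≡-Reasoning
  lc : ∀ {x y} → _ → _ → adj (G * w) x y ≡ adj G x y xor (adj G x w ∧ adj G w y)
  lc {x} {y} sx ty = trans (lc-off G w λ { refl → disj sx ty })
    (cong (λ b → adj G x y xor (adj G x w ∧ b)) (adj-sym G y w))

Cut-lc : (G : Graph n) {S T : Fin n → Set} {w : Fin n} → (∀ {x} → S x → T x → ⊥) → S w ⊎ T w → Cut G S T → Cut (G * w) S T
Cut-lc G disj (inj₁ sw) c = Cut-lcˡ G disj sw c
Cut-lc G {w = w} disj (inj₂ tw) c = Cut-sym (G * w) (Cut-lcˡ G (flip disj) tw (Cut-sym G c))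

-- Lists and linear layouts

Unique-++-disjoint : {A : Set} (as : List A) {bs : List A} → Unique (as ++ bs) → ∀ {x} → x ∈ as → x ∈ bs → ⊥
Unique-++-disjoint (a ∷ as) (p ∷ u) (here refl) x∈bs = All.lookup p (∈-++⁺ʳ as x∈bs) refl
Unique-++-disjoint (a ∷ as) (p ∷ u) (there x∈as) x∈bs = Unique-++-disjoint as u x∈as x∈bs

Unique-++ˡ : {A : Set} (as : List A) {bs : List A} → Unique (as ++ bs) → Unique as
Unique-++ˡ []       u       = []
Unique-++ˡ (a ∷ as) (p ∷ u) = All.++⁻ˡ as p ∷ Unique-++ˡ as u

Unique-++ʳ : {A : Set} (as : List A) {bs : List A} → Unique (as ++ bs) → Unique bs
Unique-++ʳ []       u       = u
Unique-++ʳ (a ∷ as) (_ ∷ u) = Unique-++ʳ as u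

Unique-resp-↭ : {A : Set} {xs ys : List A} → xs ↭ ys → Unique xs → Unique ys
Unique-resp-↭ {A} = SetoidPerm.Unique-resp-↭ (setoid A) ∘ ↭⇒↭ₛ

search : {A : Set} (f : A → Bool) (l : List A) →
  (∃ λ z → z ∈ l × f z ≡ true) ⊎ (∀ {z} → z ∈ l → f z ≡ false)
search f [] = inj₂ λ ()
search f (x ∷ l) with dichotomy (f x) | search f l
... | inj₁ e | _                  = inj₁ (x , here refl , e)
... | inj₂ e | inj₁ (z , z∈l , e′) = inj₁ (z , there z∈l , e′)
... | inj₂ e | inj₂ none          = inj₂ λ { (here refl) → e ; (there z∈l) → none z∈l }

-- Locates a cut of a concatenation relative to its seam; the case analyses on where a layout is cut
-- rest on it.
++-≡-++ : {A : Set} (as {bs} ps {qs} : List A) → as ++ bs ≡ ps ++ qs →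
  (∃ λ ms → ps ≡ as ++ ms × bs ≡ ms ++ qs) ⊎ (∃ λ ms → as ≡ ps ++ ms × qs ≡ ms ++ bs)
++-≡-++ [] ps e = inj₁ (ps , refl , e)
++-≡-++ (a ∷ as) [] e = inj₂ (a ∷ as , refl , sym e)
++-≡-++ (a ∷ as) (p ∷ ps) e with List.∷-injective e
... | refl , e′ with ++-≡-++ as ps e′
... | inj₁ (ms , refl , refl) = inj₁ (ms , refl , refl)
... | inj₂ (ms , refl , refl) = inj₂ (ms , refl , refl)

++-⊆-split : {A : Set} (as {bs l} : List A) → as ++ bs ⊆ l →
  ∃₂ λ as′ bs′ → as′ ++ bs′ ≡ l × as ⊆ as′ × bs ⊆ bs′
++-⊆-split [] {l = l} s = [] , l , refl , Sublist.[] , s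
++-⊆-split (a ∷ as) (y ∷ʳ s) with ++-⊆-split (a ∷ as) s
... | as′ , bs′ , refl , p , q = y ∷ as′ , bs′ , refl , y ∷ʳ p , q
++-⊆-split (a ∷ as) (refl Sublist.∷ s) with ++-⊆-split as s
... | as′ , bs′ , refl , p , q = a ∷ as′ , bs′ , refl , refl Sublist.∷ p , q

-- The order of l is a linear layout of width at most 1 of the subgraph induced on l.
Lin : Graph n → List (Fin n) → Set
Lin G l = ∀ as bs → as ++ bs ≡ l → Cut G (_∈ as) (_∈ bs)

Lin-⊆ : {G : Graph n} {l′ l : List (Fin n)} → l′ ⊆ l → Lin G l → Lin G l′
Lin-⊆ {G = G} s lin as bs refl with ++-⊆-split as s
... | as′ , bs′ , e , p , q = Cut-⊆ʳ G {S = _∈ as} (⊆-lookup q) (Cut-⊆ˡ G {T = _∈ bs′} (⊆-lookup p) (lin as′ bs′ e))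

Lin-cong : {G H : Graph n} {l : List (Fin n)} → (∀ x y → adj G x y ≡ adj H x y) → Lin G l → Lin H l
Lin-cong {G = G} {H} e lin as bs p = Cut-cong {G = G} {H} {_∈ as} {_∈ bs} e (lin as bs p)

-- Uniqueness makes the two sides of a cut disjoint, and `w` lies on one of them, so `Cut-lc`
-- applies to every cut.
Lin-lc : {G : Graph n} {l : List (Fin n)} {w : Fin n} → Unique l → w ∈ l → Lin G l → Lin (G * w) l
Lin-lc {G = G} u w∈l lin as bs refl =
  Cut-lc G {_∈ as} {_∈ bs} (Unique-++-disjoint as u) (∈-++⁻ as w∈l) (lin as bs refl)

Lin-unlc : {G : Graph n} {l : List (Fin n)} {w : Fin n} → Unique l → w ∈ l → Lin (G * w) l → Lin G l
Lin-unlc {G = G} {w = w} u w∈l lin =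
  Lin-cong {G = (G * w) * w} {G} (lc-involutive G w) (Lin-lc {G = G * w} u w∈l lin)

Lin-reverse : {G : Graph n} {l : List (Fin n)} → Lin G l → Lin G (reverse l)
Lin-reverse {G = G} {l} lin as bs e =
  Cut-⊆ˡ G {T = _∈ bs} Any.reverse⁺ (Cut-⊆ʳ G {S = _∈ reverse as} Any.reverse⁺ (Cut-sym G (lin (reverse bs) (reverse as)
    (trans (sym (List.reverse-++ as bs)) (trans (cong reverse e) (List.reverse-involutive l))))))

-- A cut divides at most one of the two lists; the vertices of the other one have zero rows with
-- respect to the opposite side.
Lin-++ : {G : Graph n} (ps {qs} : List (Fin n)) → Lin G ps → Lin G qs →
  (∀ {x y} → x ∈ ps → y ∈ qs → adj G x y ≡ false) → Lin G (ps ++ qs)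
Lin-++ {G = G} ps {qs} linP linQ none as bs e with ++-≡-++ as ps e
... | inj₁ (ms , refl , refl) = Cut-sym G {_∈ ms ++ qs} (Cut-dominated G {S = _∈ ms} (Cut-sym G (linP as ms refl)) dom)
  where
  dom : ∀ {x} → x ∈ ms ++ qs → Dominated G (_∈ ms) (_∈ as) x
  dom {x} x∈ with ∈-++⁻ ms x∈
  ... | inj₁ x∈ms = inj₂ (x , x∈ms , λ _ → refl)
  ... | inj₂ x∈qs = inj₁ λ {y} y∈as → trans (adj-sym G x y) (none (∈-++⁺ˡ y∈as) x∈qs)
... | inj₂ (ms , refl , refl) = Cut-dominated G {S = _∈ ms} (linQ ms bs refl) dom
  where
  dom : ∀ {x} → x ∈ ps ++ ms → Dominated G (_∈ ms) (_∈ bs) x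
  dom {x} x∈ with ∈-++⁻ ps x∈
  ... | inj₁ x∈ps = inj₁ λ y∈bs → none x∈ps (∈-++⁺ʳ ms y∈bs)
  ... | inj₂ x∈ms = inj₂ (x , x∈ms , λ _ → refl)

-- Within l, the two vertices are twins, one is pendant at the other, or one is isolated.
Pair : Graph n → List (Fin n) → Set
Pair G l = ∃₂ λ a x → a ∈ l × x ∈ l × a ≢ x × Cut G (_∈ a ∷ x ∷ []) (λ y → y ∈ l × y ≢ a × y ≢ x)

pair-disjoint : {l : List (Fin n)} {a x : Fin n} → ∀ {y} → y ∈ a ∷ x ∷ [] → y ∈ l × y ≢ a × y ≢ x → ⊥
pair-disjoint (here refl)         (_ , ≢a , _) = ≢a refl
pair-disjoint (there (here refl)) (_ , _ , ≢x) = ≢x refl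

-- The pair is one side of a cut of `l` of rank at most 1, and such cuts survive local
-- complementation at any vertex of `l`.
Pair-unlc : {G : Graph n} {l : List (Fin n)} {w : Fin n} → w ∈ l → Pair (G * w) l → Pair G l
Pair-unlc {G = G} {l} {w} w∈l (a , x , a∈l , x∈l , a≢x , c) = a , x , a∈l , x∈l , a≢x ,
  Cut-cong {G = (G * w) * w} {G} {_∈ a ∷ x ∷ []} {λ y → y ∈ l × y ≢ a × y ≢ x} (lc-involutive G w)
    (Cut-lc (G * w) pair-disjoint side c)
  where
  side : w ∈ a ∷ x ∷ [] ⊎ (w ∈ l × w ≢ a × w ≢ x)
  side with w Fin.≟ a | w Fin.≟ x
  ... | yes e | _     = inj₁ (here e)
  ... | _     | yes e = inj₁ (there (here e))
  ... | no ¬a | no ¬x = inj₂ (w∈l , ¬a , ¬x)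

module _ {G : Graph n} {l : List (Fin n)} {a x : Fin n} (a∈l : a ∈ l) (x∈l : x ∈ l) (a≢x : a ≢ x) where

  pendant-pair : (∀ {y} → y ∈ l → y ≢ a → y ≢ x → adj G x y ≡ false) → Pair G l
  pendant-pair z = a , x , a∈l , x∈l , a≢x , Cut-multiples G a λ
    { (here refl) → inj₂ λ _ → refl
    ; (there (here refl)) → inj₁ λ (y∈l , ≢a , ≢x) → z y∈l ≢a ≢x }

  twin-pair : (∀ {y} → y ∈ l → y ≢ a → y ≢ x → adj G x y ≡ adj G a y) → Pair G l
  twin-pair z = a , x , a∈l , x∈l , a≢x , Cut-multiples G a λ
    { (here refl) → inj₂ λ _ → refl
    ; (there (here refl)) → inj₂ λ (y∈l , ≢a , ≢x) → z y∈l ≢a ≢x }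

-- The three ways for two rows over GF(2) to be dependent. The case `equal` records a common
-- neighbour `z`, because complementing at it turns false twins into true ones.
data Parallel (G : Graph n) (t u : Fin n) (R : List (Fin n)) : Set where
  zeroˡ : (∀ {y} → y ∈ R → adj G t y ≡ false) → Parallel G t u R
  zeroʳ : (∀ {y} → y ∈ R → adj G u y ≡ false) → Parallel G t u R
  equal : ∀ {z} → z ∈ R → adj G t z ≡ true → (∀ {y} → y ∈ R → adj G t y ≡ adj G u y) → Parallel G t u R

parallel : (G : Graph n) {t u : Fin n} (R : List (Fin n)) → Cut G (_∈ t ∷ u ∷ []) (_∈ R) → Parallel G t u R
parallel G {t} {u} R c with search (adj G t) R | search (adj G u) R
... | inj₂ z | _ = zeroˡ z
... | _ | inj₂ z = zeroʳ z
... | inj₁ (y₁ , y₁∈ , e₁) | inj₁ (y₂ , y₂∈ , e₂) = equal y₁∈ e₁ λ {y} y∈ →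
  trans (sym (Bool.∧-identityʳ _)) (trans (cong (adj G t y ∧_) (sym uy₁))
    (trans (sym (c (here refl) (there (here refl)) y₁∈ y∈)) (cong (_∧ adj G u y) e₁)))
  where
  uy₁ : adj G u y₁ ≡ true
  -- In the minor on the columns `y₁` and `y₂` one product is 1, hence so is the other.
  uy₁ = proj₂ (∧-true (trans (sym (c (here refl) (there (here refl)) y₁∈ y₂∈)) (cong₂ _∧_ e₁ e₂)))

Lin-parallel : {G : Graph n} {t u : Fin n} {R : List (Fin n)} → Lin G (t ∷ u ∷ R) → Parallel G t u R
Lin-parallel {G = G} {t} {u} {R} lin = parallel G R (lin (t ∷ u ∷ []) R refl)

module _ (G : Graph n) {t u : Fin n} {R : List (Fin n)} (t∉R : t ∉ R) (u∉R : u ∉ R) where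

  -- Complementing at `u` adds row `u` on `R` to row `t`, and the two are equal there.
  true-twin→pendant : adj G t u ≡ true → (∀ {y} → y ∈ R → adj G t y ≡ adj G u y) →
    ∀ {y} → y ∈ R → adj (G * u) t y ≡ false
  true-twin→pendant tu e {y} y∈ = trans (lc-off G u λ { refl → t∉R y∈ })
    (trans (cong₂ _xor_ (e y∈) (cong₂ _∧_ tu (adj-sym G y u))) (Bool.xor-same (adj G u y)))

  -- Row `u` is zero on `R`, so complementing at its neighbour `t` turns it into row `t`.
  pendant→true-twin : adj G t u ≡ true → (∀ {y} → y ∈ R → adj G u y ≡ false) →
    ∀ {y} → y ∈ R → adj (G * t) t y ≡ adj (G * t) u y
  pendant→true-twin tu z {y} y∈ = trans (lc-centreˡ G t y) (sym (trans (lc-off G t λ { refl → u∉R y∈ })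
    (trans (cong₂ (λ a b → a xor (b ∧ adj G y t)) (z y∈) (trans (adj-sym G u t) tu)) (adj-sym G y t))))

  -- As `z` is adjacent to both, the pair `t`, `u` becomes adjacent, and both rows change by the
  -- same row.
  false-twin→true-twin : ∀ {z} → z ∈ R → adj G t z ≡ true → t ≢ u → adj G t u ≡ false →
    (∀ {y} → y ∈ R → adj G t y ≡ adj G u y) →
    adj (G * z) t u ≡ true × (∀ {y} → y ∈ R → adj (G * z) t y ≡ adj (G * z) u y)
  false-twin→true-twin {z} z∈ tz t≢u tu e =
    trans (lc-toggle G z t≢u tz (trans (sym (e z∈)) tz)) (cong not tu) ,
    λ {y} y∈ → trans (lc-off G z λ { refl → t∉R y∈ })
      (trans (cong₂ (λ a b → a xor (b ∧ adj G y z)) (e y∈) (e z∈)) (sym (lc-off G z λ { refl → u∉R y∈ })))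

-- Vertex-minors

lcs : Graph n → List (Fin n) → Graph n
lcs = foldl _*_

-- Since a deletion commutes with local complementation at another vertex, the deletions can be postponed to the end.
record VM (G : Graph m) (H : Graph n) : Set where
  constructor vm
  field
    centres   : List (Fin m)
    embed     : Fin n → Fin m
    injective : ∀ {i j} → embed i ≡ embed j → i ≡ j
    agrees    : ∀ i j → adj H i j ≡ adj (lcs G centres) (embed i) (embed j)

VM-unlc : {G : Graph m} {H : Graph n} (w : Fin m) → VM (G * w) H → VM G H
VM-unlc w (vm ws f inj e) = vm (w ∷ ws) f inj e

=ᶠ-embed : {f : Fin n → Fin m} → (∀ {i j} → f i ≡ f j → i ≡ j) → ∀ i j → (i =ᶠ j) ≡ (f i =ᶠ f j)
=ᶠ-embed {f = f} inj i j with i Fin.≟ j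
... | yes refl = trans (=ᶠ-refl i) (sym (=ᶠ-refl (f i)))
... | no  i≢j  = trans (=ᶠ-≢ i≢j) (sym (=ᶠ-≢ (i≢j ∘ inj)))

-- Passing to an induced subgraph commutes with local complementation at its vertices.
lcs-embed : {K : Graph n} {G : Graph m} {f : Fin n → Fin m} → (∀ {i j} → f i ≡ f j → i ≡ j) →
  (∀ i j → adj K i j ≡ adj G (f i) (f j)) → ∀ ws i j → adj (lcs K ws) i j ≡ adj (lcs G (map f ws)) (f i) (f j)
lcs-embed inj e []       i j = e i j
lcs-embed {K = K} {G} {f} inj e (w ∷ ws) i j = lcs-embed {K = K * w} {G * f w} inj
  (λ i j → cong₂ _xor_ (e i j) (cong₂ _∧_ (e i w) (cong₂ (λ a b → a ∧ not b) (e j w) (=ᶠ-embed inj i j)))) ws i j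

VM-induced : {K : Graph k} {G : Graph m} {H : Graph n} (f : Fin k → Fin m) → (∀ {i j} → f i ≡ f j → i ≡ j) →
  (∀ i j → adj K i j ≡ adj G (f i) (f j)) → VM K H → VM G H
VM-induced {K = K} {G} f inj e (vm ws g ginj ge) = vm (map f ws) (f ∘ g) (ginj ∘ inj)
  (λ i j → trans (ge i j) (lcs-embed {K = K} {G} inj e ws (g i) (g j)))

Reach⇒VM : {G : Graph m} {K : Graph k} → Reach G K → VM G K
Reach⇒VM done = vm [] id id λ _ _ → refl
Reach⇒VM {G = G} (del v r) = VM-induced {K = delete G v} {G} (punchIn v) (Fin.punchIn-injective v _ _) (λ _ _ → refl) (Reach⇒VM r)
Reach⇒VM (loc v r) = VM-unlc v (Reach⇒VM r)

HasVertexMinor⇒VM : {G : Graph m} {H : Graph n} → HasVertexMinor G H → VM G H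
HasVertexMinor⇒VM {G = G} {H} (_ , K , r , σ , e) with Reach⇒VM r
... | vm ws f inj fe = vm ws (f ∘ Inverse.from σ)
  (λ p → trans (sym (Inverse.strictlyInverseˡ σ _)) (trans (cong (Inverse.to σ) (inj p)) (Inverse.strictlyInverseˡ σ _)))
  λ i j → trans (sym (cong₂ (adj H) (Inverse.strictlyInverseˡ σ i) (Inverse.strictlyInverseˡ σ j)))
    (trans (sym (e (Inverse.from σ i) (Inverse.from σ j))) (fe _ _))

locs : {G : Graph m} {K : Graph k} (ws : List (Fin m)) → Reach (lcs G ws) K → Reach G K
locs []       r = r
locs (w ∷ ws) r = loc w (locs ws r)

-- A vertex missed by `f` is deleted and the rest is done by induction; once no vertex is missed,
-- `f` is a bijection and hence an isomorphism.
induced⇒Reach : {G : Graph m} {H : Graph n} (f : Fin n → Fin m) → (∀ {i j} → f i ≡ f j → i ≡ j) →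
  (∀ i j → adj H i j ≡ adj G (f i) (f j)) → HasVertexMinor G H
induced⇒Reach {m} {n} {G} {H} f inj e with Fin.any? (λ v → Fin.all? (λ i → ¬? (f i Fin.≟ v)))
induced⇒Reach {suc m} {n} {G} {H} f inj e | yes (v , missed) with
  induced⇒Reach {G = delete G v} {H} (λ i → punchOut (missed i ∘ sym))
    (λ p → inj (Fin.punchOut-injective (missed _ ∘ sym) (missed _ ∘ sym) p))
    (λ i j → trans (e i j) (sym (cong₂ (adj G) (Fin.punchIn-punchOut (missed i ∘ sym)) (Fin.punchIn-punchOut (missed j ∘ sym)))))
... | k , K , r , iso = k , K , del v r , iso
induced⇒Reach {m} {n} {G} {H} f inj e | no all-hit = m , G , done , mk↔ₛ′ g f (λ i → inj (fg (f i))) fg ,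
  λ i j → trans (sym (cong₂ (adj G) (fg i) (fg j))) (sym (e (g i) (g j)))
  where
  hit : ∀ v → ∃ λ i → f i ≡ v
  hit v with Fin.any? (λ i → f i Fin.≟ v)
  ... | yes h = h
  ... | no ¬h = contradiction (v , λ i p → ¬h (i , p)) all-hit
  g : Fin m → Fin n
  g v = proj₁ (hit v)
  fg : ∀ v → f (g v) ≡ v
  fg v = proj₂ (hit v)

VM⇒HasVertexMinor : {G : Graph m} {H : Graph n} → VM G H → HasVertexMinor G H
VM⇒HasVertexMinor {G = G} {H} (vm ws f inj e) with induced⇒Reach {G = lcs G ws} {H} f inj e
... | k , K , r , iso = k , K , locs ws r , iso

-- Copies of small graphs given by explicit tables

Row : (n : ℕ) → (Fin n → Set) → Set
Row zero    P = ⊤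
Row (suc n) P = P zero × Row n (P ∘ suc)

Triangle : (n : ℕ) → (Fin n → Fin n → Set) → Set
Triangle zero    R = ⊤
Triangle (suc n) R = Row n (λ j → R zero (suc j)) × Triangle n (λ i j → R (suc i) (suc j))

row-lookup : {P : Fin n → Set} → Row n P → ∀ i → P i
row-lookup (p , r) zero    = p
row-lookup (p , r) (suc i) = row-lookup r i

triangle-lookup : {R : Fin n → Fin n → Set} → (∀ i j → R i j → R j i) → Triangle n R → ∀ i j → i ≢ j → R i j
triangle-lookup s (r , t) zero    zero    ≢ = contradiction refl ≢
triangle-lookup s (r , t) zero    (suc j) ≢ = row-lookup r j
triangle-lookup s (r , t) (suc i) zero    ≢ = s _ _ (row-lookup r i)
triangle-lookup s (r , t) (suc i) (suc j) ≢ = triangle-lookup (λ i j → s (suc i) (suc j)) t i j (≢ ∘ cong suc)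

-- The pairs i < j suffice, since adjacency is symmetric and no vertex is adjacent to itself;
-- injectivity is read off the same table.
VM-on : {K : Graph k} {G : Graph m} {H : Graph n} (f : Vec (Fin m) k) →
  Triangle k (λ i j → Vec.lookup f i ≢ Vec.lookup f j × adj K i j ≡ adj G (Vec.lookup f i) (Vec.lookup f j)) →
  VM K H → VM G H
VM-on {k} {m} {K = K} {G} f t = VM-induced {K = K} {G} (Vec.lookup f) inj agree
  where
  at : ∀ i j → i ≢ j → Vec.lookup f i ≢ Vec.lookup f j × adj K i j ≡ adj G (Vec.lookup f i) (Vec.lookup f j)
  at = triangle-lookup (λ { i j (≢ , e) → ≢ ∘ sym , trans (adj-sym K j i) (trans e (adj-sym G _ _)) }) t
  inj : ∀ {i j} → Vec.lookup f i ≡ Vec.lookup f j → i ≡ j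
  inj {i} {j} p with i Fin.≟ j
  ... | yes e = e
  ... | no  ≢ = contradiction p (proj₁ (at i j ≢))
  agree : ∀ i j → adj K i j ≡ adj G (Vec.lookup f i) (Vec.lookup f j)
  agree i j with i Fin.≟ j
  ... | yes refl = trans (adj-irrefl K i) (sym (adj-irrefl G _))
  ... | no  ≢    = proj₂ (at i j ≢)

-- Pairs

data IsPath (G : Graph n) : Fin n → List (Fin n) → Set where
  []   : ∀ {t} → IsPath G t []
  step : ∀ {t s l} → adj G t s ≡ true → (∀ {u} → u ∈ l → adj G t u ≡ false) → IsPath G s l → IsPath G t (s ∷ l)

IsPath-lc : {G : Graph n} {w t : Fin n} {l : List (Fin n)} → (∀ {s} → s ∈ l → adj G s w ≡ false) →
  IsPath G t l → IsPath (G * w) t l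
IsPath-lc z [] = []
IsPath-lc {G = G} {w} z (step e f p) = step (trans (lc-skipʳ G w (z (here refl))) e)
  (λ u∈ → trans (lc-skipʳ G w (z (there u∈))) (f u∈)) (IsPath-lc (z ∘ there) p)

-- `v` is adjacent to the far end of the path, the last entry of `l`. For the empty list nothing is
-- required yet: whether `v` sees the start of the path is decided when the path first grows.
Anchored : Graph n → Fin n → List (Fin n) → Set
Anchored G v []          = ⊤
Anchored G v (y ∷ [])    = adj G v y ≡ true
Anchored G v (_ ∷ s ∷ l) = Anchored G v (s ∷ l)

Anchored-lc : {G : Graph n} {w v : Fin n} {l : List (Fin n)} → (∀ {s} → s ∈ l → adj G s w ≡ false) →
  Anchored G v l → Anchored (G * w) v l
Anchored-lc {l = []}         z a = tt
Anchored-lc {G = G} {w} {l = y ∷ []} z a = trans (lc-skipʳ G w (z (here refl))) a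
Anchored-lc {G = G} {w} {v} {_ ∷ s ∷ l} z a = Anchored-lc {G = G} {w} {v} {s ∷ l} (z ∘ there) a

C5-refl : VM C5 C5
C5-refl = vm [] id id λ _ _ → refl

induced-C5 : {G : Graph n} {v t s s′ s″ : Fin n} → Unique (v ∷ t ∷ s ∷ s′ ∷ s″ ∷ []) → IsPath G t (s ∷ s′ ∷ s″ ∷ []) →
  adj G v t ≡ true → adj G v s ≡ false → adj G v s′ ≡ false → adj G v s″ ≡ true → VM G C5
induced-C5 {G = G} {v} {t} {s} {s′} {s″}
  ((v≢t ∷ v≢s ∷ v≢s′ ∷ v≢s″ ∷ []) ∷ (t≢s ∷ t≢s′ ∷ t≢s″ ∷ []) ∷ (s≢s′ ∷ s≢s″ ∷ []) ∷ (s′≢s″ ∷ []) ∷ _)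
  (step ts t- (step ss′ s- (step s′s″ _ []))) vt vs vs′ vs″ =
  VM-on {K = C5} {G} (t ∷ s ∷ s′ ∷ s″ ∷ v ∷ [])
    ( ((t≢s , sym ts) , (t≢s′ , sym (t- (here refl))) , (t≢s″ , sym (t- (there (here refl)))) , (v≢t ∘ sym , flipped vt) , tt)
    , ((s≢s′ , sym ss′) , (s≢s″ , sym (s- (here refl))) , (v≢s ∘ sym , flipped vs) , tt)
    , ((s′≢s″ , sym s′s″) , (v≢s′ ∘ sym , flipped vs′) , tt)
    , ((v≢s″ ∘ sym , flipped vs″) , tt) , tt , tt) C5-refl
  where
  flipped : ∀ {x b} → adj G v x ≡ b → b ≡ adj G x v
  flipped {x} e = trans (sym e) (adj-sym G v x)

-- A path on at least four vertices, both of whose ends are adjacent to v. A chord from v to the vertex next to an end is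
-- removed by local complementation at that end; then the path is shortened by local complementation at its second vertex.
cycle : {G : Graph n} {v t s s′ s″ : Fin n} (l : List (Fin n)) → Unique (v ∷ t ∷ s ∷ s′ ∷ s″ ∷ l) →
  IsPath G t (s ∷ s′ ∷ s″ ∷ l) → adj G v t ≡ true → Anchored G v (s″ ∷ l) → VM G C5

shorten : {G : Graph n} {v t s s′ s″ : Fin n} (l : List (Fin n)) → Unique (v ∷ t ∷ s ∷ s′ ∷ s″ ∷ l) →
  IsPath G t (s ∷ s′ ∷ s″ ∷ l) → adj G v t ≡ true → adj G v s ≡ false → Anchored G v (s″ ∷ l) → VM G C5

cycle {G = G} {v} {t} {s} {s′} {s″} l u@((_ ∷ v≢s ∷ _) ∷ _) p@(step ts t- p′) vt an with dichotomy (adj G v s)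
... | inj₂ vs = shorten l u p vt vs an
... | inj₁ vs = VM-unlc t (shorten {G = G * t} l u
  (step (trans (lc-centreˡ G t s) ts) (λ {y} y∈ → trans (lc-centreˡ G t y) (t- y∈)) (IsPath-lc away p′))
  (trans (lc-centreʳ G t v) vt)
  (trans (lc-toggle G t v≢s vt (trans (adj-sym G s t) ts)) (cong not vs))
  (Anchored-lc {G = G} {l = s″ ∷ l} (away ∘ there) an))
  where
  away : ∀ {y} → y ∈ s′ ∷ s″ ∷ l → adj G y t ≡ false
  away {y} y∈ = trans (adj-sym G y t) (t- y∈)

shorten {G = G} {v} {t} {s} {s′} {s″} [] u@((_ ∷ _ ∷ v≢s′ ∷ _) ∷ _) p@(step ts t- (step ss′ s- (step s′s″ _ []))) vt vs an
  with dichotomy (adj G v s′)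
... | inj₂ vs′ = induced-C5 u p vt vs vs′ an
-- `s″` is adjacent to `v` and `s′` but to neither `t` nor `s`, so only the chord from `v` to `s′`
-- is toggled.
... | inj₁ vs′ = VM-unlc s″ (induced-C5 {G = G * s″} u
  (step (trans (lc-skipˡ G s″ ts″) ts) (λ y∈ → trans (lc-skipˡ G s″ ts″) (t- y∈))
    (step (trans (lc-skipˡ G s″ ss″) ss′) (λ y∈ → trans (lc-skipˡ G s″ ss″) (s- y∈))
      (step (trans (lc-centreʳ G s″ s′) s′s″) (λ ()) [])))
  (trans (lc-skipʳ G s″ ts″) vt) (trans (lc-skipʳ G s″ ss″) vs)
  (trans (lc-toggle G s″ v≢s′ an s′s″) (cong not vs′)) (trans (lc-centreʳ G s″ v) an))
  where
  ts″ : adj G t s″ ≡ false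
  ts″ = t- (there (here refl))
  ss″ : adj G s s″ ≡ false
  ss″ = s- (here refl)
shorten {G = G} {v} {t} {s} {s′} {s″} (q ∷ l)
  ((v≢t ∷ _ ∷ v≢) ∷ (t≢s ∷ t≢s′ ∷ t≢) ∷ _ ∷ u) (step ts t- (step ss′ s- p)) vt vs an =
  VM-unlc s (cycle {G = G * s} l ((v≢t ∷ v≢) ∷ (t≢s′ ∷ t≢) ∷ u)
    (step (trans (lc-toggle G s t≢s′ ts (trans (adj-sym G s′ s) ss′)) (cong not (t- (here refl))))
      (λ y∈ → trans (lc-skipʳ G s (away y∈)) (t- (there y∈))) (IsPath-lc away p))
    (trans (lc-skipˡ G s vs) vt)
    (Anchored-lc {G = G} {l = q ∷ l} (away ∘ there) an))
  where
  away : ∀ {y} → y ∈ s″ ∷ q ∷ l → adj G y s ≡ false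
  away {y} y∈ = trans (adj-sym G y s) (s- y∈)

ʳ++-↭ : {A : Set} (l {R} : List A) → l ʳ++ R ↭ l ++ R
ʳ++-↭ []      = ↭-refl
ʳ++-↭ (x ∷ l) = ↭-trans (ʳ++-↭ l) (Perm.shift x l _)

-- The search for a pair runs along a layout of G minus v; t ∷ l is the part already read, R is still to come.
record Frontier (G : Graph n) (v t : Fin n) (l R : List (Fin n)) : Set where
  constructor frontier
  field
    path     : IsPath G t l
    anchored : Anchored G v l
    away     : ∀ {s y} → s ∈ l → y ∈ R → adj G s y ≡ false
    lin      : Lin G (t ∷ R)
open Frontier

PairOrC5 : Graph n → List (Fin n) → Set
PairOrC5 G l = Pair G l ⊎ VM G C5

PairOrC5-unlc : {G : Graph n} {l : List (Fin n)} {w : Fin n} → w ∈ l → PairOrC5 (G * w) l → PairOrC5 G l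
PairOrC5-unlc {G = G} w∈ (inj₁ p) = inj₁ (Pair-unlc {G = G} w∈ p)
PairOrC5-unlc {w = w} w∈ (inj₂ o) = inj₂ (VM-unlc w o)

-- With the part already read stored backwards, the ambient list is `v ∷ (l ʳ++ t ∷ R)`. It stays
-- definitionally the same when `t` is pushed onto `l`, so one uniqueness proof serves the whole
-- search.
module Distinct {A : Set} {v : A} (t : A) (l R : List A) (u : Unique (v ∷ (l ʳ++ t ∷ R))) where

  private
    u′ : Unique (v ∷ t ∷ l ++ R)
    u′ = Unique-resp-↭ (prep v (↭-trans (ʳ++-↭ l) (Perm.shift t l R))) u

  v≢ : ∀ {y} → y ∈ t ∷ l ++ R → v ≢ y
  v≢ y∈ with u′
  ... | p ∷ _ = All.lookup p y∈

  t≢ : ∀ {y} → y ∈ l ++ R → t ≢ y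
  t≢ y∈ with u′
  ... | _ ∷ p ∷ _ = All.lookup p y∈

  unique-lR : Unique (l ++ R)
  unique-lR with u′
  ... | _ ∷ _ ∷ p = p

  l≢R : ∀ {x y} → x ∈ l → y ∈ R → x ≢ y
  l≢R x∈ y∈ refl = Unique-++-disjoint l unique-lR x∈ y∈

  unique-tR : Unique (t ∷ R)
  unique-tR = All.tabulate (λ y∈ → t≢ (∈-++⁺ʳ l y∈)) ∷ Unique-++ʳ l unique-lR

  unique-vtl : Unique (v ∷ t ∷ l)
  unique-vtl = Unique-++ˡ (v ∷ t ∷ l) u′

  member : ∀ {y} → y ∈ v ∷ (l ʳ++ t ∷ R) → y ≡ v ⊎ y ≡ t ⊎ y ∈ l ⊎ y ∈ R
  member (here e) = inj₁ e
  member (there y∈) with ∈-++⁻ l (Perm.∈-resp-↭ (ʳ++-↭ l) y∈)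
  ... | inj₁ y∈l         = inj₂ (inj₂ (inj₁ y∈l))
  ... | inj₂ (here e)    = inj₂ (inj₁ e)
  ... | inj₂ (there y∈R) = inj₂ (inj₂ (inj₂ y∈R))

  t∈ : t ∈ v ∷ (l ʳ++ t ∷ R)
  t∈ = there (Perm.∈-resp-↭ (↭-sym (ʳ++-↭ l)) (∈-insert l))

  l∈ : ∀ {y} → y ∈ l → y ∈ v ∷ (l ʳ++ t ∷ R)
  l∈ y∈ = there (Perm.∈-resp-↭ (↭-sym (ʳ++-↭ l)) (∈-++⁺ˡ y∈))

  R∈ : ∀ {y} → y ∈ R → y ∈ v ∷ (l ʳ++ t ∷ R)
  R∈ y∈ = there (Perm.∈-resp-↭ (↭-sym (ʳ++-↭ l)) (∈-++⁺ʳ l (there y∈)))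

Frontier-lc : {G : Graph n} {v t w : Fin n} {l R : List (Fin n)} → Unique (t ∷ R) → w ∈ t ∷ R →
  (∀ {s} → s ∈ l → adj G s w ≡ false) → Frontier G v t l R → Frontier (G * w) v t l R
Frontier-lc {G = G} {v} {w = w} {l} u w∈ z (frontier p an aw lin) = frontier (IsPath-lc z p) (Anchored-lc {G = G} {w} {v} {l} z an)
  (λ s∈ y∈ → trans (lc-skipˡ G w (z s∈)) (aw s∈ y∈)) (Lin-lc {G = G} u w∈ lin)

-- The path `t ∷ l` sends no edges to `R`. If it is a single vertex or `v` misses `t`, then `t` has
-- at most one neighbour. Otherwise `v` sees both ends: these are twins on a path of two or three
-- vertices, and a longer path yields C5.
frontier-end : {G : Graph n} {v t : Fin n} (l : List (Fin n)) {R : List (Fin n)} → Unique (v ∷ (l ʳ++ t ∷ R)) →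
  Frontier G v t l R → (∀ {y} → y ∈ R → adj G t y ≡ false) → PairOrC5 G (v ∷ (l ʳ++ t ∷ R))
frontier-end {G = G} {v} {t} [] {R} u (frontier [] _ _ _) t-R = inj₁ (pendant-pair {G = G} (here refl) t∈ (v≢ (here refl)) leaf)
  where
  open Distinct t [] R u
  leaf : ∀ {y} → y ∈ v ∷ t ∷ R → y ≢ v → y ≢ t → adj G t y ≡ false
  leaf y∈ ≢v ≢t with member y∈
  ... | inj₁ e                = contradiction e ≢v
  ... | inj₂ (inj₁ e)         = contradiction e ≢t
  ... | inj₂ (inj₂ (inj₂ y∈R)) = t-R y∈R
frontier-end {G = G} {v} {t} (s ∷ l′) {R} u (frontier (step ts t- p) an aw lin) t-R with dichotomy (adj G v t)
... | inj₂ vt = inj₁ (pendant-pair {G = G} (l∈ (here refl)) t∈ (adj-≢ G ts ∘ sym) leaf)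
  where
  open Distinct t (s ∷ l′) R u
  leaf : ∀ {y} → y ∈ v ∷ ((s ∷ l′) ʳ++ t ∷ R) → y ≢ s → y ≢ t → adj G t y ≡ false
  leaf y∈ ≢s ≢t with member y∈
  ... | inj₁ refl                      = trans (adj-sym G t v) vt
  ... | inj₂ (inj₁ e)                  = contradiction e ≢t
  ... | inj₂ (inj₂ (inj₁ (here e)))    = contradiction e ≢s
  ... | inj₂ (inj₂ (inj₁ (there y∈l))) = t- y∈l
  ... | inj₂ (inj₂ (inj₂ y∈R))         = t-R y∈R
frontier-end {G = G} {v} {t} (y₀ ∷ []) {R} u (frontier (step ty t- []) an aw lin) t-R | inj₁ vt =
  inj₁ (twin-pair {G = G} (l∈ (here refl)) t∈ (adj-≢ G ty ∘ sym) twins)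
  where
  open Distinct t (y₀ ∷ []) R u
  twins : ∀ {y} → y ∈ v ∷ ((y₀ ∷ []) ʳ++ t ∷ R) → y ≢ y₀ → y ≢ t → adj G t y ≡ adj G y₀ y
  twins y∈ ≢y₀ ≢t with member y∈
  ... | inj₁ refl                   = trans (trans (adj-sym G t v) (trans vt (sym an))) (adj-sym G v y₀)
  ... | inj₂ (inj₁ e)               = contradiction e ≢t
  ... | inj₂ (inj₂ (inj₁ (here e))) = contradiction e ≢y₀
  ... | inj₂ (inj₂ (inj₂ y∈R))      = trans (t-R y∈R) (sym (aw (here refl) y∈R))
frontier-end {G = G} {v} {t} (s ∷ y₀ ∷ []) {R} u (frontier (step ts t- (step sy _ [])) an aw lin) t-R | inj₁ vt =
  inj₁ (twin-pair {G = G} (l∈ (there (here refl))) t∈ (t≢ (there (here refl)) ∘ sym) twins)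
  where
  open Distinct t (s ∷ y₀ ∷ []) R u
  twins : ∀ {y} → y ∈ v ∷ ((s ∷ y₀ ∷ []) ʳ++ t ∷ R) → y ≢ y₀ → y ≢ t → adj G t y ≡ adj G y₀ y
  twins y∈ ≢y₀ ≢t with member y∈
  ... | inj₁ refl                           = trans (trans (adj-sym G t v) (trans vt (sym an))) (adj-sym G v y₀)
  ... | inj₂ (inj₁ e)                       = contradiction e ≢t
  ... | inj₂ (inj₂ (inj₁ (here refl)))      = trans ts (trans (sym sy) (adj-sym G s y₀))
  ... | inj₂ (inj₂ (inj₁ (there (here e)))) = contradiction e ≢y₀
  ... | inj₂ (inj₂ (inj₂ y∈R))              = trans (t-R y∈R) (sym (aw (there (here refl)) y∈R))
frontier-end {G = G} {v} {t} (s ∷ s′ ∷ s″ ∷ l′) {R} u (frontier p an aw lin) t-R | inj₁ vt = inj₂ (cycle l′ (Distinct.unique-vtl t (s ∷ s′ ∷ s″ ∷ l′) R u) p vt an)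

module _ {n} (v : Fin n) where

  -- The cut behind `t` and `u` makes their rows on `R` dependent. Each case ends the search or is
  -- turned, by complementations that leave the path intact, into the one where `u` is the only
  -- neighbour of `t` still to come and the path grows.
  search-pair : ∀ (R : List (Fin n)) {G t l} → Unique (v ∷ (l ʳ++ t ∷ R)) → Frontier G v t l R → PairOrC5 G (v ∷ (l ʳ++ t ∷ R))

  advance : ∀ (u : Fin n) R {G t l} → Unique (v ∷ (l ʳ++ t ∷ u ∷ R)) → Frontier G v t l (u ∷ R) →
    adj G t u ≡ true → (∀ {y} → y ∈ R → adj G t y ≡ false) → PairOrC5 G (v ∷ (l ʳ++ t ∷ u ∷ R))
  advance u R {G} {t} {l} uq (frontier p an aw lin) tu t-R = go l refl
    where
    open Distinct t l (u ∷ R) uq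
    next : Anchored G v (t ∷ l) → Frontier G v u (t ∷ l) R
    next an′ = frontier (step (trans (adj-sym G u t) tu) (λ {y} y∈ → trans (adj-sym G u y) (aw y∈ (here refl))) p) an′
      (λ { (here refl) y∈ → t-R y∈ ; (there s∈) y∈ → aw s∈ (there y∈) }) (Lin-⊆ {G = G} (t ∷ʳ ⊆-refl) lin)
    leaf : adj G v t ≡ false → l ≡ [] → ∀ {y} → y ∈ v ∷ (l ʳ++ t ∷ u ∷ R) → y ≢ u → y ≢ t → adj G t y ≡ false
    leaf vt refl y∈ ≢u ≢t with member y∈
    ... | inj₁ refl                         = trans (adj-sym G t v) vt
    ... | inj₂ (inj₁ e)                     = contradiction e ≢t
    ... | inj₂ (inj₂ (inj₂ (here e)))       = contradiction e ≢u
    ... | inj₂ (inj₂ (inj₂ (there y∈R)))    = t-R y∈R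
    go : ∀ l′ → l′ ≡ l → PairOrC5 G (v ∷ (l ʳ++ t ∷ u ∷ R))
    go (_ ∷ _) refl = search-pair R uq (next an)
    -- Here `t` becomes the far end of the path, so it has to be adjacent to `v`; otherwise it is
    -- pendant at `u`.
    go [] refl with dichotomy (adj G v t)
    ... | inj₁ vt = search-pair R uq (next vt)
    ... | inj₂ vt = inj₁ (pendant-pair {G = G} (R∈ (here refl)) t∈ (adj-≢ G tu ∘ sym) (leaf vt refl))

  advance-twin : ∀ (u : Fin n) R {G t l} → Unique (v ∷ (l ʳ++ t ∷ u ∷ R)) → Frontier G v t l (u ∷ R) →
    adj G t u ≡ true → (∀ {y} → y ∈ R → adj G t y ≡ adj G u y) → PairOrC5 G (v ∷ (l ʳ++ t ∷ u ∷ R))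
  advance-twin u R {G} {t} {l} uq fr tu e with Distinct.unique-tR t l (u ∷ R) uq
  ... | uqT@((_ ∷ t∉R) ∷ u∉R ∷ _) = PairOrC5-unlc {G = G} (Distinct.R∈ t l (u ∷ R) uq (here refl))
    (advance u R uq (Frontier-lc {G = G} uqT (there (here refl)) (λ s∈ → away fr s∈ (here refl)) fr)
      (trans (lc-centreʳ G u t) tu)
      (true-twin→pendant G (λ y∈ → All.lookup t∉R y∈ refl) (λ y∈ → All.lookup u∉R y∈ refl) tu e))

  -- While nothing precedes `t`, complementing at `t` makes the leaf `u` its true twin. Later this
  -- could disturb the path; then `u` is either missed by `v`, hence pendant at `t`, or the end of a
  -- path on at least three vertices with both ends adjacent to `v`, which gives twins or C5.
  advance-leaf : ∀ (u : Fin n) R {G t l} → Unique (v ∷ (l ʳ++ t ∷ u ∷ R)) → Frontier G v t l (u ∷ R) →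
    adj G t u ≡ true → (∀ {y} → y ∈ R → adj G u y ≡ false) → PairOrC5 G (v ∷ (l ʳ++ t ∷ u ∷ R))
  advance-leaf u R {G} {t} {[]} uq fr tu u-R with Distinct.unique-tR t [] (u ∷ R) uq
  ... | uqT@((_ ∷ t∉R) ∷ u∉R ∷ _) = PairOrC5-unlc {G = G} (there (here refl))
    (advance-twin u R uq (Frontier-lc {G = G} uqT (here refl) (λ ()) fr) (trans (lc-centreˡ G t u) tu)
      (pendant→true-twin G (λ y∈ → All.lookup t∉R y∈ refl) (λ y∈ → All.lookup u∉R y∈ refl) tu u-R))
  advance-leaf u R {G} {t} {s ∷ l} uq (frontier p@(step ts t- p′) an aw lin) tu u-R with dichotomy (adj G v u)
  ... | inj₂ vu = inj₁ (pendant-pair {G = G} t∈ (R∈ (here refl)) (adj-≢ G tu) leaf)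
    where
    open Distinct t (s ∷ l) (u ∷ R) uq
    leaf : ∀ {y} → y ∈ v ∷ ((s ∷ l) ʳ++ t ∷ u ∷ R) → y ≢ t → y ≢ u → adj G u y ≡ false
    leaf {y} y∈ ≢t ≢u with member y∈
    ... | inj₁ refl                      = trans (adj-sym G u v) vu
    ... | inj₂ (inj₁ e)                  = contradiction e ≢t
    ... | inj₂ (inj₂ (inj₁ y∈l))         = trans (adj-sym G u y) (aw y∈l (here refl))
    ... | inj₂ (inj₂ (inj₂ (here e)))    = contradiction e ≢u
    ... | inj₂ (inj₂ (inj₂ (there y∈R))) = u-R y∈R
  advance-leaf u R {G} {t} {y₀ ∷ []} uq (frontier (step ty t- []) an aw lin) tu u-R | inj₁ vu =
    inj₁ (twin-pair {G = G} (l∈ (here refl)) (R∈ (here refl)) (l≢R (here refl) (here refl)) twins)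
    where
    open Distinct t (y₀ ∷ []) (u ∷ R) uq
    twins : ∀ {y} → y ∈ v ∷ y₀ ∷ t ∷ u ∷ R → y ≢ y₀ → y ≢ u → adj G u y ≡ adj G y₀ y
    twins y∈ ≢y₀ ≢u with member y∈
    ... | inj₁ refl                      = trans (trans (adj-sym G u v) (trans vu (sym an))) (adj-sym G v y₀)
    ... | inj₂ (inj₁ refl)               = trans (adj-sym G u t) (trans (trans tu (sym ty)) (adj-sym G t y₀))
    ... | inj₂ (inj₂ (inj₁ (here e)))    = contradiction e ≢y₀
    ... | inj₂ (inj₂ (inj₂ (here e)))    = contradiction e ≢u
    ... | inj₂ (inj₂ (inj₂ (there y∈R))) = trans (u-R y∈R) (sym (aw (here refl) (there y∈R)))
  advance-leaf u R {G} {t} {s ∷ s′ ∷ l} uq (frontier p@(step ts t- p′) an aw lin) tu u-R | inj₁ vu =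
    inj₂ (cycle l (Distinct.unique-vtl u (t ∷ s ∷ s′ ∷ l) R uq)
      (step (trans (adj-sym G u t) tu) (λ {y} y∈ → trans (adj-sym G u y) (aw y∈ (here refl))) p) vu an)

  search-pair []      uq fr = frontier-end _ uq fr λ ()
  search-pair (u ∷ R) {G} {t} {l} uq fr with Lin-parallel {G = G} (lin fr) | dichotomy (adj G t u)
  ... | zeroˡ z | inj₁ tu = advance u R uq fr tu z
  ... | zeroˡ z | inj₂ tu = frontier-end _ uq fr λ { (here refl) → tu ; (there y∈) → z y∈ }
  ... | zeroʳ z | inj₁ tu = advance-leaf u R uq fr tu z
  ... | zeroʳ z | inj₂ tu = inj₁ (pendant-pair {G = G} (here refl) (R∈ (here refl)) (v≢ (there (∈-++⁺ʳ l (here refl)))) isolated)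
    where
    open Distinct t l (u ∷ R) uq
    isolated : ∀ {y} → y ∈ v ∷ (l ʳ++ t ∷ u ∷ R) → y ≢ v → y ≢ u → adj G u y ≡ false
    isolated {y} y∈ ≢v ≢u with member y∈
    ... | inj₁ e                         = contradiction e ≢v
    ... | inj₂ (inj₁ refl)               = trans (adj-sym G u t) tu
    ... | inj₂ (inj₂ (inj₁ y∈l))         = trans (adj-sym G u y) (away fr y∈l (here refl))
    ... | inj₂ (inj₂ (inj₂ (here e)))    = contradiction e ≢u
    ... | inj₂ (inj₂ (inj₂ (there y∈R))) = z y∈R
  search-pair (u ∷ R) {G} {t} {l} uq fr | equal z∈ tz e | inj₁ tu = advance-twin u R uq fr tu e
  search-pair (u ∷ R) {G} {t} {l} uq fr | equal {z} z∈ tz e | inj₂ tu with Distinct.unique-tR t l (u ∷ R) uq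
  ... | uqT@((t≢u ∷ t∉R) ∷ u∉R ∷ _) with
    false-twin→true-twin G {R = R} (λ y∈ → All.lookup t∉R y∈ refl) (λ y∈ → All.lookup u∉R y∈ refl) z∈ tz t≢u tu e
  ... | tu′ , e′ = PairOrC5-unlc {G = G} (Distinct.R∈ t l (u ∷ R) uq (there z∈))
    (advance-twin u R uq (Frontier-lc {G = G} uqT (there (there z∈)) (λ s∈ → away fr s∈ (there z∈)) fr) tu′ e′)

pair-or-C5 : {G : Graph n} {v : Fin n} {t : Fin n} {R : List (Fin n)} → Unique (v ∷ t ∷ R) → Lin G (t ∷ R) → PairOrC5 G (v ∷ t ∷ R)
pair-or-C5 {v = v} {R = R} uq lin = search-pair v R {l = []} uq (frontier [] tt (λ ()) lin)

-- Inserting a pendant vertex or twin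

search₂ : {A : Set} (f : A → A → Bool) (l l′ : List A) →
  (∃₂ λ x y → x ∈ l × y ∈ l′ × f x y ≡ true) ⊎ (∀ {x y} → x ∈ l → y ∈ l′ → f x y ≡ false)
search₂ f [] l′ = inj₂ λ ()
search₂ f (x ∷ l) l′ with search (f x) l′ | search₂ f l l′
... | inj₁ (y , y∈ , e) | _ = inj₁ (x , y , here refl , y∈ , e)
... | inj₂ _ | inj₁ (x′ , y , x∈ , y∈ , e) = inj₁ (x′ , y , there x∈ , y∈ , e)
... | inj₂ none | inj₂ none′ = inj₂ λ { (here refl) y∈ → none y∈ ; (there x∈) y∈ → none′ x∈ y∈ }

separate : {A : Set} (f : A → Bool) (l : List A) → ∃₂ λ l₀ l₁ → l₀ ++ l₁ ↭ l × l₀ ⊆ l × l₁ ⊆ l ×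
  (∀ {z} → z ∈ l₀ → f z ≡ false) × (∀ {z} → z ∈ l₁ → f z ≡ true)
separate f [] = [] , [] , ↭-refl , Sublist.[] , Sublist.[] , (λ ()) , λ ()
separate f (x ∷ l) with separate f l | dichotomy (f x)
... | l₀ , l₁ , p , s₀ , s₁ , z₀ , z₁ | inj₁ e = l₀ , x ∷ l₁ , ↭-trans (Perm.shift x l₀ l₁) (prep x p) ,
  x ∷ʳ s₀ , refl Sublist.∷ s₁ , z₀ , λ { (here refl) → e ; (there z∈) → z₁ z∈ }
... | l₀ , l₁ , p , s₀ , s₁ , z₀ , z₁ | inj₂ e = x ∷ l₀ , l₁ , prep x p ,
  refl Sublist.∷ s₀ , x ∷ʳ s₁ , (λ { (here refl) → e ; (there z∈) → z₀ z∈ }) , z₁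

Layout : Graph n → List (Fin n) → Set
Layout G l = ∃ λ zs → zs ↭ l × Lin G zs

Outcome : Graph n → List (Fin n) → Set
Outcome G l = Layout G l ⊎ VM G N ⊎ VM G Q

Outcome-unlc : {G : Graph n} {l : List (Fin n)} {w : Fin n} → Unique l → w ∈ l → Outcome (G * w) l → Outcome G l
Outcome-unlc {G = G} u w∈ (inj₁ (zs , p , lin)) =
  inj₁ (zs , p , Lin-unlc {G = G} (Unique-resp-↭ (↭-sym p) u) (Perm.∈-resp-↭ (↭-sym p) w∈) lin)
Outcome-unlc {w = w} u w∈ (inj₂ (inj₁ o)) = inj₂ (inj₁ (VM-unlc w o))
Outcome-unlc {w = w} u w∈ (inj₂ (inj₂ o)) = inj₂ (inj₂ (VM-unlc w o))

Cut-singleton : (G : Graph n) (a : Fin n) {T : Fin n → Set} → Cut G (_∈ a ∷ []) T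
Cut-singleton G a = Cut-multiples G a λ { (here refl) → inj₂ λ _ → refl }

Lin-single : (G : Graph n) (x : Fin n) → Lin G (x ∷ [])
Lin-single G x []            bs e ()
Lin-single G x (_ ∷ [])      [] e _ _ ()
Lin-single G x (_ ∷ [])      (_ ∷ _) e with List.∷-injective e
... | _ , ()
Lin-single G x (_ ∷ _ ∷ as) bs e with List.∷-injective e
... | _ , ()

Lin-two : (G : Graph n) (a x : Fin n) → Lin G (a ∷ x ∷ [])
Lin-two G a x []           bs e ()
Lin-two G a x (_ ∷ [])     bs e = Cut-singleton G _
Lin-two G a x (_ ∷ _ ∷ []) [] e _ _ ()
Lin-two G a x (_ ∷ _ ∷ []) (_ ∷ _) ()
Lin-two G a x (_ ∷ _ ∷ _ ∷ _) bs ()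

-- Three pairwise adjacent vertices p, a, r (numbered 0, 1, 2) with partners p′, x, r′ (3, 4, 5). The partner x is pendant;
-- p′ is a false twin of p if b holds and pendant otherwise, and likewise for r′ and c.
tripodRows : Bool → Bool → Vec (Vec Bool 6) 6
tripodRows b c =
    (false ∷ true  ∷ true  ∷ not b ∷ false ∷ c     ∷ [])
  ∷ (true  ∷ false ∷ true  ∷ b     ∷ true  ∷ c     ∷ [])
  ∷ (true  ∷ true  ∷ false ∷ b     ∷ false ∷ not c ∷ [])
  ∷ (not b ∷ b     ∷ b     ∷ false ∷ false ∷ b ∧ c ∷ [])
  ∷ (false ∷ true  ∷ false ∷ false ∷ false ∷ false ∷ [])
  ∷ (c     ∷ c     ∷ not c ∷ b ∧ c ∷ false ∷ false ∷ [])
  ∷ []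

tripod : Bool → Bool → Graph 6
tripod b c = record
  { adj        = λ i j → entry b c i j
  ; adj-sym    = from-yes (∀? λ b → ∀? λ c → Fin.all? λ i → Fin.all? λ j → entry b c i j Bool.≟ entry b c j i) b c
  ; adj-irrefl = from-yes (∀? λ b → ∀? λ c → Fin.all? λ i → entry b c i i Bool.≟ false) b c }
  where
  entry : Bool → Bool → Fin 6 → Fin 6 → Bool
  entry b c i j = Vec.lookup (Vec.lookup (tripodRows b c) i) j

IsCopy : Graph m → Graph n → Vec (Fin m) n → Set
IsCopy G H f = (∀ i j → Vec.lookup f i ≡ Vec.lookup f j → i ≡ j) × (∀ i j → adj H i j ≡ adj G (Vec.lookup f i) (Vec.lookup f j))

isCopy? : (G : Graph m) (H : Graph n) (f : Vec (Fin m) n) → Dec (IsCopy G H f)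
isCopy? G H f =
  (Fin.all? λ i → Fin.all? λ j → (Vec.lookup f i Fin.≟ Vec.lookup f j) →-dec (i Fin.≟ j)) ×-dec
  (Fin.all? λ i → Fin.all? λ j → adj H i j Bool.≟ adj G (Vec.lookup f i) (Vec.lookup f j))

copy⇒VM : {G : Graph m} {H : Graph n} (ws : List (Fin m)) (f : Vec (Fin m) n) → IsCopy (lcs G ws) H f → VM G H
copy⇒VM ws f (inj , e) = vm ws (Vec.lookup f) (inj _ _) e

-- Of the four graphs, those with equal parameters lead to N and the other two to Q; the copies are
-- verified by evaluation.
tripod-obstruction : ∀ b c → VM (tripod b c) N ⊎ VM (tripod b c) Q
tripod-obstruction false false = inj₁ (copy⇒VM [] v (from-yes (isCopy? (tripod false false) N v)))
  where v = # 0 ∷ # 1 ∷ # 2 ∷ # 3 ∷ # 4 ∷ # 5 ∷ []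
-- Complementing at `p` removes the edge from `a` to `r`. What remains is the 4-cycle `a`, `p`, `r`,
-- `p′` with `x` pendant at `a` and `r′` at `r`; the next case is the mirror image.
tripod-obstruction true  false = inj₂ (copy⇒VM ws v (from-yes (isCopy? (lcs (tripod true false) ws) Q v)))
  where
  ws = # 0 ∷ []
  v  = # 1 ∷ # 0 ∷ # 2 ∷ # 3 ∷ # 4 ∷ # 5 ∷ []
tripod-obstruction false true  = inj₂ (copy⇒VM ws v (from-yes (isCopy? (lcs (tripod false true) ws) Q v)))
  where
  ws = # 2 ∷ []
  v  = # 1 ∷ # 2 ∷ # 0 ∷ # 5 ∷ # 4 ∷ # 3 ∷ []
-- The three complementations are a pivot on the edge from `p` to `r`: it removes the edges among
-- `a`, `p′`, `r′` and exchanges the remaining neighbours of `p` and `r`.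
tripod-obstruction true  true  = inj₁ (copy⇒VM ws v (from-yes (isCopy? (lcs (tripod true true) ws) N v)))
  where
  ws = # 0 ∷ # 2 ∷ # 0 ∷ []
  v  = # 0 ∷ # 1 ∷ # 2 ∷ # 3 ∷ # 4 ∷ # 5 ∷ []

Lin-isolated : (G : Graph n) {x : Fin n} (l : List (Fin n)) → Lin G l → (∀ {y} → y ∈ l → adj G x y ≡ false) → Lin G (x ∷ l)
Lin-isolated G {x} l lin z = Lin-++ {G = G} (x ∷ []) (Lin-single G x) lin λ { (here refl) → z }

-- The shape forced by a triangle `p`, `a`, `r` across `a`: the adjacency between `P` and `R` is the
-- outer product of the two parts of row `a`.
Block : Graph n → Fin n → (P R : List (Fin n)) → Set
Block G a P R = ∀ {p r} → p ∈ P → r ∈ R → adj G p r ≡ adj G a p ∧ adj G a r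

module _ (G : Graph n) {a x : Fin n} (P R : List (Fin n)) (lin : Lin G (P ++ a ∷ R))
  (x-P : ∀ {y} → y ∈ P → adj G x y ≡ false) (x-R : ∀ {y} → y ∈ R → adj G x y ≡ false) where

  -- The only new cut separates `a` from `x`, and there row `a` is the only one that can be nonzero.
  -- In every other cut `x` is on the side of `a` and contributes a zero row.
  Lin-insert-after : (∀ {p r} → p ∈ P → r ∈ R → adj G p r ≡ false) → Lin G (P ++ a ∷ x ∷ R)
  Lin-insert-after P-R as bs e with ++-≡-++ as P e
  ... | inj₁ (ms , refl , refl) = Cut-sym G {_∈ ms ++ a ∷ x ∷ R} (Cut-dominated G {S = _∈ ms ++ a ∷ R}
      (Cut-sym G (lin as (ms ++ a ∷ R) (sym (List.++-assoc as ms (a ∷ R))))) dom)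
    where
    dom : ∀ {y} → y ∈ ms ++ a ∷ x ∷ R → Dominated G (_∈ ms ++ a ∷ R) (_∈ as) y
    dom {y} y∈ with ∈-++⁻ ms y∈
    ... | inj₁ y∈ms                = inj₂ (y , ∈-++⁺ˡ y∈ms , λ _ → refl)
    ... | inj₂ (here refl)         = inj₂ (a , ∈-++⁺ʳ ms (here refl) , λ _ → refl)
    ... | inj₂ (there (here refl)) = inj₁ λ y∈as → x-P (∈-++⁺ˡ y∈as)
    ... | inj₂ (there (there y∈R)) = inj₂ (y , ∈-++⁺ʳ ms (there y∈R) , λ _ → refl)
  ... | inj₂ ([] , refl , refl) = Cut-sym G {_∈ a ∷ x ∷ R} (Cut-dominated G {S = _∈ a ∷ R} {T = _∈ P ++ []}
      (Cut-⊆ʳ G {S = _∈ a ∷ R} (λ y∈ → subst (_ ∈_) (List.++-identityʳ P) y∈) (Cut-sym G (lin P (a ∷ R) refl))) dom)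
    where
    dom : ∀ {y} → y ∈ a ∷ x ∷ R → Dominated G (_∈ a ∷ R) (_∈ P ++ []) y
    dom {y} (here refl)         = inj₂ (a , here refl , λ _ → refl)
    dom {y} (there (here refl)) = inj₁ λ y∈ → x-P (subst (_ ∈_) (List.++-identityʳ P) y∈)
    dom {y} (there (there y∈R)) = inj₂ (y , there y∈R , λ _ → refl)
  ... | inj₂ (_ ∷ [] , refl , refl) = Cut-multiples G a row
    where
    row : ∀ {p} → p ∈ P ++ a ∷ [] →
      (∀ {y} → y ∈ x ∷ R → adj G p y ≡ false) ⊎ (∀ {y} → y ∈ x ∷ R → adj G p y ≡ adj G a y)
    row {p} p∈ with ∈-++⁻ P p∈
    ... | inj₁ p∈P         = inj₁ λ { (here refl) → trans (adj-sym G p x) (x-P p∈P) ; (there y∈R) → P-R p∈P y∈R }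
    ... | inj₂ (here refl) = inj₂ λ _ → refl
  ... | inj₂ (_ ∷ _ ∷ ms , refl , refl) = Cut-dominated G {S = _∈ P ++ a ∷ ms} (lin (P ++ a ∷ ms) bs (List.++-assoc P (a ∷ ms) bs)) dom
    where
    dom : ∀ {y} → y ∈ P ++ a ∷ x ∷ ms → Dominated G (_∈ P ++ a ∷ ms) (_∈ bs) y
    dom {y} y∈ with ∈-++⁻ P y∈
    ... | inj₁ y∈P                  = inj₂ (y , ∈-++⁺ˡ y∈P , λ _ → refl)
    ... | inj₂ (here refl)          = inj₂ (a , ∈-++⁺ʳ P (here refl) , λ _ → refl)
    ... | inj₂ (there (here refl))  = inj₁ λ y∈bs → x-R (∈-++⁺ʳ ms y∈bs)
    ... | inj₂ (there (there y∈ms)) = inj₂ (y , ∈-++⁺ʳ P (there y∈ms) , λ _ → refl)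

  -- If the neighbours of a in P form a clique without further neighbours in P, then a and x can be moved in front of them.
  Layout-clique : Unique P → Block G a P R → (∀ {p p′} → p ∈ P → p′ ∈ P → p ≢ p′ → adj G a p ≡ true → adj G p p′ ≡ adj G a p′) →
    Layout G (x ∷ P ++ a ∷ R)
  Layout-clique uP block clique with separate (adj G a) P
  ... | P₀ , A , perm , P₀⊆ , A⊆ , a-P₀ , a-A = P₀ ++ a ∷ x ∷ A ++ R , reorder , Lin-++ {G = G} P₀
      (Lin-⊆ {G = G} (Sublist.⊆-trans P₀⊆ (Sublist.++⁺ʳ (a ∷ R) ⊆-refl)) lin) tail apart
    where
    open PermutationReasoning
    reorder : P₀ ++ a ∷ x ∷ A ++ R ↭ x ∷ P ++ a ∷ R
    reorder = begin
      P₀ ++ a ∷ x ∷ A ++ R   ↭⟨ Perm.++⁺ˡ P₀ (swap a x ↭-refl) ⟩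
      P₀ ++ x ∷ a ∷ A ++ R   ↭⟨ Perm.shift x P₀ (a ∷ A ++ R) ⟩
      x ∷ P₀ ++ a ∷ A ++ R   ↭⟨ prep x (Perm.++⁺ˡ P₀ (↭-sym (Perm.shift a A R))) ⟩
      x ∷ P₀ ++ A ++ a ∷ R   ≡⟨ cong (x ∷_) (List.++-assoc P₀ A (a ∷ R)) ⟨
      x ∷ (P₀ ++ A) ++ a ∷ R ↭⟨ prep x (Perm.++⁺ʳ (a ∷ R) perm) ⟩
      x ∷ P ++ a ∷ R         ∎

    apart : ∀ {p y} → p ∈ P₀ → y ∈ a ∷ x ∷ A ++ R → adj G p y ≡ false
    apart {p} p∈ (here refl) = trans (adj-sym G p a) (a-P₀ p∈)
    apart {p} p∈ (there (here refl)) = trans (adj-sym G p x) (x-P (⊆-lookup P₀⊆ p∈))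
    apart {p} {y} p∈ (there (there y∈)) with ∈-++⁻ A y∈
    ... | inj₂ y∈R = trans (block (⊆-lookup P₀⊆ p∈) y∈R) (cong (_∧ adj G a y) (a-P₀ p∈))
    ... | inj₁ y∈A = trans (adj-sym G p y) (trans (clique (⊆-lookup A⊆ y∈A) (⊆-lookup P₀⊆ p∈)
      (λ { refl → true≢false (a-A y∈A) (a-P₀ p∈) }) (a-A y∈A)) (a-P₀ p∈))

    uA : Unique A
    uA = Unique-++ʳ P₀ (Unique-resp-↭ (↭-sym perm) uP)

    -- A cut inside `A` sees only zero rows and copies of row `a`, by the clique condition and
    -- `block`; a cut inside `R` gains only the zero row of `x`.
    tail : Lin G (a ∷ x ∷ A ++ R)
    tail [] bs e ()
    tail (_ ∷ []) bs e = Cut-singleton G _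
    tail (_ ∷ _ ∷ as) bs e with List.∷-injective e
    ... | refl , e′ with List.∷-injective e′
    ... | refl , e″ with ++-≡-++ as A e″
    ... | inj₁ (ms , refl , refl) = Cut-multiples G a row
      where
      row : ∀ {y} → y ∈ a ∷ x ∷ as →
        (∀ {z} → z ∈ ms ++ R → adj G y z ≡ false) ⊎ (∀ {z} → z ∈ ms ++ R → adj G y z ≡ adj G a z)
      row (here refl) = inj₂ λ _ → refl
      row (there (here refl)) = inj₁ λ z∈ →
        [ (λ z∈ms → x-P (⊆-lookup A⊆ (∈-++⁺ʳ as z∈ms))) , (λ z∈R → x-R z∈R) ]′ (∈-++⁻ ms z∈)
      row {y} (there (there y∈)) = inj₂ λ {z} z∈ → [ within , across ]′ (∈-++⁻ ms z∈)
        where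
        within : ∀ {z} → z ∈ ms → adj G y z ≡ adj G a z
        within z∈ = clique (⊆-lookup A⊆ (∈-++⁺ˡ y∈)) (⊆-lookup A⊆ (∈-++⁺ʳ as z∈))
          (λ { refl → Unique-++-disjoint as uA y∈ z∈ }) (a-A (∈-++⁺ˡ y∈))
        across : ∀ {z} → z ∈ R → adj G y z ≡ adj G a z
        across {z} z∈ = trans (block (⊆-lookup A⊆ (∈-++⁺ˡ y∈)) z∈) (cong (_∧ adj G a z) (a-A (∈-++⁺ˡ y∈)))
    ... | inj₂ (ms , refl , refl) = Cut-dominated G {S = _∈ P ++ a ∷ ms} (lin (P ++ a ∷ ms) bs (List.++-assoc P (a ∷ ms) bs)) dom
      where
      dom : ∀ {y} → y ∈ a ∷ x ∷ A ++ ms → Dominated G (_∈ P ++ a ∷ ms) (_∈ bs) y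
      dom (here refl) = inj₂ (a , ∈-++⁺ʳ P (here refl) , λ _ → refl)
      dom (there (here refl)) = inj₁ λ z∈ → x-R (∈-++⁺ʳ ms z∈)
      dom {y} (there (there y∈)) with ∈-++⁻ A y∈
      ... | inj₁ y∈A  = inj₂ (y , ∈-++⁺ˡ (⊆-lookup A⊆ y∈A) , λ _ → refl)
      ... | inj₂ y∈ms = inj₂ (y , ∈-++⁺ʳ P (there y∈ms) , λ _ → refl)

-- If p, a, r is a triangle with p before and r after a, then p′ prevents a from being moved past p.
Partner : Graph n → Fin n → List (Fin n) → Set
Partner G a P = ∃₂ λ p p′ → p ∈ P × p′ ∈ P × p ≢ p′ × adj G a p ≡ true × adj G p p′ ≡ not (adj G a p′)

Clique : Graph n → Fin n → List (Fin n) → Set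
Clique G a P = ∀ {p p′} → p ∈ P → p′ ∈ P → p ≢ p′ → adj G a p ≡ true → adj G p p′ ≡ adj G a p′

partner? : (G : Graph n) (a : Fin n) (P : List (Fin n)) → Partner G a P ⊎ Clique G a P
partner? G a P with search₂ (λ p p′ → adj G a p ∧ (not (p =ᶠ p′) ∧ (adj G p p′ xor adj G a p′))) P P
... | inj₁ (p , p′ , p∈ , p′∈ , e) with ∧-true {adj G a p} e
... | e₁ , e₂ with ∧-true {not (p =ᶠ p′)} e₂
... | e₃ , e₄ = inj₁ (p , p′ , p∈ , p′∈ , (λ { refl → true≢false e₃ (cong not (=ᶠ-refl p)) }) , e₁ , differ _ _ e₄)
  where
  differ : ∀ b c → b xor c ≡ true → b ≡ not c
  differ true  false refl = refl
  differ false true  refl = refl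
partner? G a P | inj₂ none = inj₂ λ {p} {p′} p∈ p′∈ p≢ ap → agree _ _ (trans
  (sym (cong₂ _∧_ ap (cong (λ b → not b ∧ (adj G p p′ xor adj G a p′)) (=ᶠ-≢ p≢)))) (none p∈ p′∈))
  where
  agree : ∀ b c → b xor c ≡ false → b ≡ c
  agree true  true  refl = refl
  agree false false refl = refl

reverse-around : {A : Set} (P : List A) (a : A) (R : List A) → reverse (P ++ a ∷ R) ≡ reverse R ++ a ∷ reverse P
reverse-around P a R = trans (List.reverse-++ P (a ∷ R))
  (trans (cong (_++ reverse P) (List.unfold-reverse a R)) (List.++-assoc (reverse R) (a ∷ []) (reverse P)))

module _ {n} (P R : List (Fin n)) {a x : Fin n} (uq : Unique (x ∷ P ++ a ∷ R)) where

  private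
    ambient : List (Fin n)
    ambient = x ∷ P ++ a ∷ R
    uPaR : Unique (P ++ a ∷ R)
    uPaR = Unique-++ʳ (x ∷ []) uq
    P≢ : ∀ {p y} → p ∈ P → y ∈ a ∷ R → p ≢ y
    P≢ p∈ y∈ refl = Unique-++-disjoint P uPaR p∈ y∈
    a≢R : ∀ {r} → r ∈ R → a ≢ r
    a≢R r∈ = All.lookup (AllPairs.head (Unique-++ʳ P uPaR)) r∈
    x≢ : ∀ {y} → y ∈ P ++ a ∷ R → x ≢ y
    x≢ y∈ = All.lookup (AllPairs.head uq) y∈
    P∈ : ∀ {p} → p ∈ P → p ∈ ambient
    P∈ p∈ = there (∈-++⁺ˡ p∈)
    R∈ : ∀ {r} → r ∈ R → r ∈ ambient
    R∈ r∈ = there (∈-++⁺ʳ P (there r∈))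
    a∈ : a ∈ ambient
    a∈ = there (∈-insert P)
    uR : Unique R
    uR = AllPairs.tail (Unique-++ʳ P uPaR)

    around : ∀ {y} → y ∈ P ++ R → y ∈ P ++ a ∷ R
    around y∈ = [ ∈-++⁺ˡ , (λ y∈R → ∈-++⁺ʳ P (there y∈R)) ]′ (∈-++⁻ P y∈)
    x∉ : x ∉ P ++ R
    x∉ y∈ = x≢ (around y∈) refl
    a∉ : a ∉ P ++ R
    a∉ y∈ with ∈-++⁻ P y∈
    ... | inj₁ y∈P = P≢ y∈P (here refl) refl
    ... | inj₂ y∈R = a≢R y∈R refl

  record Leaf (G : Graph n) : Set where
    constructor leaf
    field
      lin : Lin G (P ++ a ∷ R)
      a-x : adj G a x ≡ true
      x-0 : ∀ {y} → y ∈ P ++ R → adj G x y ≡ false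
  open Leaf

  private
    Leaf-lc : ∀ {G w} → w ∈ P ++ R → Leaf G → Leaf (G * w)
    Leaf-lc {G} {w} w∈ (leaf l ax x0) = leaf (Lin-lc {G = G} uPaR (around w∈) l)
      (trans (lc-skipʳ G w (x0 w∈)) ax) (λ y∈ → trans (lc-skipˡ G w (x0 w∈)) (x0 y∈))

  -- A clique on either side lets `a` and `x` be moved past it, after reversing the layout if it
  -- lies in `R`. Otherwise both sides have partners, and together with `a` and `x` they induce a
  -- tripod.
  insert-at-block : {G : Graph n} → Leaf G → Block G a P R → Outcome G ambient
  insert-at-block {G} lf block with partner? G a P | partner? G a R
  ... | inj₂ clique | _ = inj₁ (Layout-clique G P R (lin lf) (x-0 lf ∘ ∈-++⁺ˡ) (x-0 lf ∘ ∈-++⁺ʳ P) (Unique-++ˡ P uPaR) block clique)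
  ... | _ | inj₂ clique with Layout-clique G (reverse R) (reverse P)
      (subst (Lin G) (reverse-around P a R) (Lin-reverse {G = G} (lin lf)))
      (x-0 lf ∘ ∈-++⁺ʳ P ∘ Any.reverse⁻) (λ y∈ → x-0 lf (∈-++⁺ˡ (Any.reverse⁻ {xs = P} y∈)))
      (Unique-resp-↭ (↭-sym (Perm.↭-reverse R)) uR)
      (λ {r} {p} r∈ p∈ → trans (adj-sym G r p) (trans (block (Any.reverse⁻ p∈) (Any.reverse⁻ r∈)) (Bool.∧-comm (adj G a p) _)))
      (λ r∈ r′∈ → clique (Any.reverse⁻ r∈) (Any.reverse⁻ r′∈))
  ... | zs , perm , l = inj₁ (zs , ↭-trans perm (prep x (↭-trans (↭-reflexive (sym (reverse-around P a R))) (Perm.↭-reverse _))) , l)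
  insert-at-block {G} lf block | inj₁ (p , p′ , p∈ , p′∈ , p≢p′ , ap , pp′) | inj₁ (r , r′ , r∈ , r′∈ , r≢r′ , ar , rr′) =
    inj₂ ([ inj₁ ∘ found , inj₂ ∘ found ]′ (tripod-obstruction (adj G a p′) (adj G a r′)))
    where
    b c : Bool
    b = adj G a p′
    c = adj G a r′
    cross : ∀ {p r u v} → p ∈ P → r ∈ R → adj G a p ≡ u → adj G a r ≡ v → u ∧ v ≡ adj G p r
    cross p∈ r∈ e f = sym (trans (block p∈ r∈) (cong₂ _∧_ e f))
    at-x : ∀ {y} → y ∈ P ++ R → false ≡ adj G y x
    at-x {y} y∈ = trans (sym (x-0 lf y∈)) (adj-sym G x y)
    found : ∀ {m} {H : Graph m} → VM (tripod b c) H → VM G H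
    -- The edges between the two sides come from `block` and those inside a side from the partners,
    -- so the adjacencies of `a` to `p′` and `r′` are the only freedom.
    found = VM-on {K = tripod b c} {G} (p ∷ a ∷ r ∷ p′ ∷ x ∷ r′ ∷ [])
      ( ((P≢ p∈ (here refl) , trans (sym ap) (adj-sym G a p)) , (P≢ p∈ (there r∈) , cross p∈ r∈ ap ar) , (p≢p′ , sym pp′)
        , (x≢ (∈-++⁺ˡ p∈) ∘ sym , at-x (∈-++⁺ˡ p∈)) , (P≢ p∈ (there r′∈) , cross p∈ r′∈ ap refl) , tt)
      , ((a≢R r∈ , sym ar) , (P≢ p′∈ (here refl) ∘ sym , refl) , (x≢ (∈-insert P) ∘ sym , sym (a-x lf)) , (a≢R r′∈ , refl) , tt)
      , ((P≢ p′∈ (there r∈) ∘ sym , trans (sym (Bool.∧-identityʳ b)) (trans (cross p′∈ r∈ refl ar) (adj-sym G p′ r)))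
        , (x≢ (∈-++⁺ʳ P (there r∈)) ∘ sym , at-x (∈-++⁺ʳ P r∈)) , (r≢r′ , sym rr′) , tt)
      , ((x≢ (∈-++⁺ˡ p′∈) ∘ sym , at-x (∈-++⁺ˡ p′∈)) , (P≢ p′∈ (there r′∈) , cross p′∈ r′∈ refl refl) , tt)
      , ((x≢ (∈-++⁺ʳ P (there r′∈)) , sym (x-0 lf (∈-++⁺ʳ P r′∈))) , tt) , tt , tt)

  -- The cut in front of `a` ties the row of any `p′` on `a ∷ R` to that of `p`, and the cut behind
  -- `a` equates the rows of `p` and `a` on `R`; together they give the product form.
  insert-at-triangle : {G : Graph n} → Leaf G → ∀ {p r} → p ∈ P → r ∈ R →
    adj G a p ≡ true → adj G a r ≡ true → adj G p r ≡ true → Outcome G ambient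
  insert-at-triangle {G} lf {p} {r} p∈ r∈ ap ar pr = insert-at-block lf block
    where
    open ≡-Reasoning
    pa : adj G p a ≡ true
    pa = trans (adj-sym G p a) ap
    block : Block G a P R
    block {p′} {r′} p′∈ r′∈ = begin
      adj G p′ r′               ≡⟨ cong (_∧ adj G p′ r′) pa ⟨
      adj G p a ∧ adj G p′ r′   ≡⟨ lin lf P (a ∷ R) refl p∈ p′∈ (here refl) (there r′∈) ⟩
      adj G p r′ ∧ adj G p′ a   ≡⟨ cong₂ _∧_ ar′ (adj-sym G p′ a) ⟩
      adj G a r′ ∧ adj G a p′   ≡⟨ Bool.∧-comm (adj G a r′) _ ⟩
      adj G a p′ ∧ adj G a r′   ∎
      where
      ar′ : adj G p r′ ≡ adj G a r′
      ar′ = begin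
        adj G p r′               ≡⟨ Bool.∧-identityʳ _ ⟨
        adj G p r′ ∧ true        ≡⟨ cong (adj G p r′ ∧_) ar ⟨
        adj G p r′ ∧ adj G a r   ≡⟨ lin lf (P ++ a ∷ []) R (List.++-assoc P (a ∷ []) R) (∈-++⁺ˡ p∈) (∈-insert P) r∈ r′∈ ⟨
        adj G p r ∧ adj G a r′   ≡⟨ cong (_∧ adj G a r′) pr ⟩
        adj G a r′               ∎

  -- Without edges from `P` to `R` the leaf goes directly behind `a`. Given such an edge,
  -- complementing at the one end adjacent to `a` completes a triangle; if `a` sees neither end, the
  -- minors through the edge show that `a` and `x` are cut off from all other vertices.
  insert-leaf : {G : Graph n} → Leaf G → Outcome G ambient
  insert-leaf {G} lf with search₂ (adj G) P R
  ... | inj₂ none = inj₁ (P ++ a ∷ x ∷ R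
    , ↭-trans (Perm.++⁺ˡ P (swap a x ↭-refl)) (Perm.shift x P (a ∷ R))
    , Lin-insert-after G P R (lin lf) (x-0 lf ∘ ∈-++⁺ˡ) (x-0 lf ∘ ∈-++⁺ʳ P) none)
  ... | inj₁ (p , r , p∈ , r∈ , pr) with dichotomy (adj G a p) | dichotomy (adj G a r)
  ... | inj₁ ap | inj₁ ar = insert-at-triangle lf p∈ r∈ ap ar pr
  ... | inj₁ ap | inj₂ ar = Outcome-unlc {G = G} uq (P∈ p∈) (insert-at-triangle (Leaf-lc (∈-++⁺ˡ p∈) lf) p∈ r∈
      (trans (lc-centreʳ G p a) ap)
      (trans (lc-toggle G p (a≢R r∈) ap (trans (adj-sym G r p) pr)) (cong not ar))
      (trans (lc-centreˡ G p r) pr))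
  ... | inj₂ ap | inj₁ ar = Outcome-unlc {G = G} uq (R∈ r∈) (insert-at-triangle (Leaf-lc (∈-++⁺ʳ P r∈) lf) p∈ r∈
      (trans (lc-toggle G r (P≢ p∈ (here refl) ∘ sym) ar pr) (cong not ap))
      (trans (lc-centreʳ G r a) ar)
      (trans (lc-centreʳ G r p) pr))
  ... | inj₂ ap | inj₂ ar = inj₁ (a ∷ x ∷ P ++ R
    , ↭-trans (swap a x ↭-refl) (prep x (↭-sym (Perm.shift a P R)))
    , Lin-++ {G = G} (a ∷ x ∷ []) (Lin-two G a x) (Lin-⊆ {G = G} (Sublist.++⁺ (⊆-refl {x = P}) (a ∷ʳ ⊆-refl)) (lin lf)) apart)
    where
    open ≡-Reasoning
    a-0 : ∀ {y} → y ∈ P ++ R → adj G a y ≡ false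
    a-0 {y} y∈ with ∈-++⁻ P y∈
    ... | inj₁ y∈P = begin
      adj G a y               ≡⟨ adj-sym G a y ⟩
      adj G y a               ≡⟨ cong (_∧ adj G y a) pr ⟨
      adj G p r ∧ adj G y a   ≡⟨ lin lf P (a ∷ R) refl p∈ y∈P (there r∈) (here refl) ⟩
      adj G p a ∧ adj G y r   ≡⟨ cong (_∧ adj G y r) (trans (adj-sym G p a) ap) ⟩
      false                   ∎
    ... | inj₂ y∈R = begin
      adj G a y               ≡⟨ cong (_∧ adj G a y) pr ⟨
      adj G p r ∧ adj G a y   ≡⟨ lin lf (P ++ a ∷ []) R (List.++-assoc P (a ∷ []) R) (∈-++⁺ˡ p∈) (∈-insert P) r∈ y∈R ⟩
      adj G p y ∧ adj G a r   ≡⟨ cong (adj G p y ∧_) ar ⟩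
      adj G p y ∧ false       ≡⟨ Bool.∧-zeroʳ _ ⟩
      false                   ∎
    apart : ∀ {u y} → u ∈ a ∷ x ∷ [] → y ∈ P ++ R → adj G u y ≡ false
    apart (here refl)         = a-0
    apart (there (here refl)) = x-0 lf

  insert-isolated : {G : Graph n} → Lin G (P ++ a ∷ R) → adj G a x ≡ false → (∀ {y} → y ∈ P ++ R → adj G x y ≡ false) →
    Outcome G ambient
  insert-isolated {G} l ax x0 = inj₁ (ambient , ↭-refl , Lin-isolated G (P ++ a ∷ R) l isolated)
    where
    isolated : ∀ {y} → y ∈ P ++ a ∷ R → adj G x y ≡ false
    isolated y∈ with ∈-++⁻ P y∈
    ... | inj₁ y∈P         = x0 (∈-++⁺ˡ y∈P)
    ... | inj₂ (here refl) = trans (adj-sym G x a) ax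
    ... | inj₂ (there y∈R) = x0 (∈-++⁺ʳ P y∈R)

  insert-true-twin : {G : Graph n} → Lin G (P ++ a ∷ R) → adj G a x ≡ true → (∀ {y} → y ∈ P ++ R → adj G x y ≡ adj G a y) →
    Outcome G ambient
  insert-true-twin {G} l ax e = Outcome-unlc {G = G} uq a∈ (insert-leaf (leaf (Lin-lc {G = G} uPaR (∈-insert P) l)
    (trans (lc-centreˡ G a x) ax) (true-twin→pendant G x∉ a∉ (trans (adj-sym G x a) ax) e)))

  -- Twins are reduced to the pendant case by complementing at `a`, false twins first at a common
  -- neighbour; if there is none, `x` is isolated.
  insert : {G : Graph n} → Lin G (P ++ a ∷ R) →
    (∀ {y} → y ∈ P ++ R → adj G x y ≡ false) ⊎ (∀ {y} → y ∈ P ++ R → adj G x y ≡ adj G a y) → Outcome G ambient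
  insert {G} l d with d | dichotomy (adj G a x)
  ... | inj₁ x0 | inj₁ ax = insert-leaf (leaf l ax x0)
  ... | inj₁ x0 | inj₂ ax = insert-isolated l ax x0
  ... | inj₂ e  | inj₁ ax = insert-true-twin l ax e
  ... | inj₂ e  | inj₂ ax with search (adj G x) (P ++ R)
  ... | inj₂ x0 = insert-isolated l ax x0
  ... | inj₁ (z , z∈ , xz) with
    false-twin→true-twin G {R = P ++ R} x∉ a∉ z∈ xz (x≢ (∈-insert P)) (trans (adj-sym G x a) ax) e
  ... | xa , e′ = Outcome-unlc {G = G} uq (there (around z∈))
    (insert-true-twin (Lin-lc {G = G} uPaR (around z∈) l) (trans (adj-sym (G * z) a x) xa) e′)

-- Construction of a layout by induction

Obstruction : Graph n → Set
Obstruction G = VM G C5 ⊎ VM G N ⊎ VM G Q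

∈⇒↭ : {A : Set} {x : A} {l : List A} → x ∈ l → ∃ λ l′ → l ↭ x ∷ l′
∈⇒↭ {x = x} x∈ with ∈-∃++ x∈
... | ps , qs , refl = ps ++ qs , Perm.shift x ps qs

∈⇒↭₂ : {A : Set} {x a : A} {l : List A} → x ∈ l → a ∈ l → a ≢ x → ∃ λ O → l ↭ x ∷ a ∷ O
∈⇒↭₂ x∈ a∈ a≢x with ∈⇒↭ x∈
... | l′ , p with Perm.∈-resp-↭ p a∈
... | here a≡x = contradiction a≡x a≢x
... | there a∈′ with ∈⇒↭ a∈′
... | O , q = O , ↭-trans p (prep _ q)

Layout-resp-↭ : {G : Graph n} {l l′ : List (Fin n)} → l ↭ l′ → Layout G l → Layout G l′
Layout-resp-↭ p (zs , q , lin) = zs , ↭-trans q p , lin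

module _ (G : Graph n) where

  reinsert : ∀ {x a} O → Unique (x ∷ a ∷ O) →
    (∀ {y} → y ∈ O → adj G x y ≡ false) ⊎ (∀ {y} → y ∈ O → adj G x y ≡ adj G a y) →
    Layout G (a ∷ O) ⊎ Obstruction G → Layout G (x ∷ a ∷ O) ⊎ Obstruction G
  reinsert O u d (inj₂ o) = inj₂ o
  reinsert {x} {a} O u d (inj₁ (zs , perm , lin)) with ∈-∃++ (Perm.∈-resp-↭ (↭-sym perm) (here refl))
  ... | P , R , refl with insert P R (Unique-resp-↭ (prep x (↭-sym perm)) u) {G} lin (restrict d)
    where
    rest : ∀ {y} → y ∈ P ++ R → y ∈ O
    rest = Perm.∈-resp-↭ (Perm.drop-∷ (↭-trans (↭-sym (Perm.shift a P R)) perm))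
    restrict : (∀ {y} → y ∈ O → adj G x y ≡ false) ⊎ (∀ {y} → y ∈ O → adj G x y ≡ adj G a y) →
      (∀ {y} → y ∈ P ++ R → adj G x y ≡ false) ⊎ (∀ {y} → y ∈ P ++ R → adj G x y ≡ adj G a y)
    restrict (inj₁ z) = inj₁ (z ∘ rest)
    restrict (inj₂ e) = inj₂ (e ∘ rest)
  ... | inj₁ l = inj₁ (Layout-resp-↭ {G = G} (prep x perm) l)
  ... | inj₂ o = inj₂ (inj₂ o)

  -- The layout of `l` exposes a pair in `v ∷ l`. One of its vertices is zero on the other vertices
  -- or copies its companion there; it is removed, the remaining list, again of length `suc k`, is
  -- laid out by the hypothesis, and the vertex is reinserted.
  layout-step : ∀ k → (∀ l → length l ≡ suc k → Unique l → Layout G l ⊎ Obstruction G) →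
    ∀ v l → length (v ∷ l) ≡ suc (suc k) → Unique (v ∷ l) → Layout G (v ∷ l) ⊎ Obstruction G
  layout-step k rec v l e u with rec l (ℕ.suc-injective e) (AllPairs.tail u)
  ... | inj₂ o = inj₂ o
  ... | inj₁ ([] , perm , lin) with trans (Perm.↭-length perm) (ℕ.suc-injective e)
  ... | ()
  layout-step k rec v l e u | inj₁ (t ∷ R , perm , lin)
    with pair-or-C5 {G = G} (Unique-resp-↭ (prep v (↭-sym perm)) u) lin
  ... | inj₂ o = inj₂ (inj₁ o)
  ... | inj₁ (a , x , a∈ , x∈ , a≢x , cut) with ∈⇒↭₂ x∈ a∈ a≢x
  ... | O , q = split (parallel G O (Cut-⊆ʳ G {S = _∈ x ∷ a ∷ []} others (Cut-⊆ˡ G {T = λ y → y ∈ v ∷ t ∷ R × y ≢ a × y ≢ x} swapped cut)))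
    where
    perm′ : x ∷ a ∷ O ↭ v ∷ l
    perm′ = ↭-trans (↭-sym q) (prep v perm)
    uxa : Unique (x ∷ a ∷ O)
    uxa = Unique-resp-↭ (↭-sym perm′) u
    shorter : ∀ {y : Fin n} → length (y ∷ O) ≡ suc k
    shorter = ℕ.suc-injective (trans (Perm.↭-length perm′) e)
    others : ∀ {y} → y ∈ O → y ∈ v ∷ t ∷ R × y ≢ a × y ≢ x
    others y∈ = Perm.∈-resp-↭ (↭-sym q) (there (there y∈))
      , (λ { refl → All.lookup (AllPairs.head (AllPairs.tail uxa)) y∈ refl })
      , (λ { refl → All.lookup (AllPairs.head uxa) (there y∈) refl })
    swapped : ∀ {y} → y ∈ x ∷ a ∷ [] → y ∈ a ∷ x ∷ []
    swapped (here e)         = there (here e)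
    swapped (there (here e)) = here e
    uax : Unique (a ∷ x ∷ O)
    uax = Unique-resp-↭ (swap x a ↭-refl) uxa
    conclude : ∀ {l′} → l′ ↭ v ∷ l → Layout G l′ ⊎ Obstruction G → Layout G (v ∷ l) ⊎ Obstruction G
    conclude p (inj₁ lay) = inj₁ (Layout-resp-↭ {G = G} p lay)
    conclude p (inj₂ o)   = inj₂ o
    split : Parallel G x a O → Layout G (v ∷ l) ⊎ Obstruction G
    split (zeroˡ z)     = conclude perm′ (reinsert O uxa (inj₁ z) (rec (a ∷ O) (shorter {a}) (AllPairs.tail uxa)))
    split (zeroʳ z)     = conclude (↭-trans (swap a x ↭-refl) perm′)
      (reinsert O uax (inj₁ z) (rec (x ∷ O) (shorter {x}) (AllPairs.tail uax)))
    split (equal _ _ e) = conclude perm′ (reinsert O uxa (inj₂ e) (rec (a ∷ O) (shorter {a}) (AllPairs.tail uxa)))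

  layout : ∀ k l → length l ≡ k → Unique l → Layout G l ⊎ Obstruction G
  layout zero [] e u = inj₁ ([] , ↭-refl , λ { [] bs p () })
  layout (suc zero) (x ∷ []) e u = inj₁ (x ∷ [] , ↭-refl , Lin-single G x)
  layout (suc (suc k)) (v ∷ l) e u = layout-step k (layout (suc k)) v l e u

-- Cut-rank

count-pos : (S : Fin n → Bool) {x : Fin n} → S x ≡ true → 1 ≤ count S
count-pos S {zero}  e rewrite e = s≤s z≤n
count-pos S {suc x} e = ℕ.≤-trans (count-pos (S ∘ suc) e) (ℕ.m≤n+m _ _)

count-two : (S : Fin n → Bool) {x y : Fin n} → x ≢ y → S x ≡ true → S y ≡ true → 2 ≤ count S
count-two S {zero}  {zero}  ≢ p q = contradiction refl ≢
count-two S {zero}  {suc y} ≢ p q rewrite p = s≤s (count-pos (S ∘ suc) q)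
count-two S {suc x} {zero}  ≢ p q rewrite q = s≤s (count-pos (S ∘ suc) p)
count-two S {suc x} {suc y} ≢ p q = ℕ.≤-trans (count-two (S ∘ suc) (≢ ∘ cong suc) p q) (ℕ.m≤n+m _ _)

count-zero : (S : Fin n → Bool) → count S ≡ 0 ⊎ ∃ λ x → S x ≡ true
count-zero {zero}  S = inj₁ refl
count-zero {suc n} S with dichotomy (S zero) | count-zero (S ∘ suc)
... | inj₁ e | _            = inj₂ (zero , e)
... | inj₂ e | inj₂ (x , p) = inj₂ (suc x , p)
... | inj₂ e | inj₁ z rewrite e = inj₁ z

count-one : (S : Fin n → Bool) → count S ≤ 1 ⊎ ∃₂ λ x y → x ≢ y × S x ≡ true × S y ≡ true
count-one {zero}  S = inj₁ z≤n
count-one {suc n} S with dichotomy (S zero) | count-zero (S ∘ suc) | count-one (S ∘ suc)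
... | inj₁ e | inj₂ (x , p) | _ = inj₂ (zero , suc x , (λ ()) , e , p)
... | inj₁ e | inj₁ z       | _ rewrite e | z = inj₁ ℕ.≤-refl
... | inj₂ e | _ | inj₂ (x , y , ≢ , p , q) = inj₂ (suc x , suc y , ≢ ∘ Fin.suc-injective , p , q)
... | inj₂ e | _ | inj₁ ≤1 rewrite e = inj₁ ≤1

parity-none : (h : Fin n → Bool) → (∀ z → h z ≡ false) → parity h ≡ false
parity-none {zero}  h e = refl
parity-none {suc n} h e rewrite e zero = parity-none (h ∘ suc) (e ∘ suc)

parity-one : (h : Fin n → Bool) (x : Fin n) → (∀ z → z ≢ x → h z ≡ false) → parity h ≡ h x
parity-one h zero    e = trans (cong (h zero xor_) (parity-none (h ∘ suc) λ z → e (suc z) λ ())) (Bool.xor-identityʳ _)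
parity-one h (suc x) e rewrite e zero (λ ()) = parity-one (h ∘ suc) x λ z ≢ → e (suc z) (≢ ∘ Fin.suc-injective)

parity-two : (h : Fin n → Bool) (x y : Fin n) → x ≢ y → (∀ z → z ≢ x → z ≢ y → h z ≡ false) → parity h ≡ h x xor h y
parity-two h zero    zero    ≢ e = contradiction refl ≢
parity-two h zero    (suc y) ≢ e =
  cong (h zero xor_) (parity-one (h ∘ suc) y λ z z≢ → e (suc z) (λ ()) (z≢ ∘ Fin.suc-injective))
parity-two h (suc x) zero    ≢ e = trans
  (cong (h zero xor_) (parity-one (h ∘ suc) x λ z z≢ → e (suc z) (z≢ ∘ Fin.suc-injective) λ ())) (Bool.xor-comm (h zero) _)
parity-two h (suc x) (suc y) ≢ e rewrite e zero (λ ()) (λ ()) = parity-two (h ∘ suc) x y (≢ ∘ cong suc)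
  λ z z≢x z≢y → e (suc z) (z≢x ∘ Fin.suc-injective) (z≢y ∘ Fin.suc-injective)

=ᶠ⇒≡ : {x y : Fin n} → (x =ᶠ y) ≡ true → x ≡ y
=ᶠ⇒≡ {x = x} {y} e with x Fin.≟ y
... | yes p = p
... | no  ≢ = ⊥-elim (true≢false e (=ᶠ-≢ ≢))

both : Fin n → Fin n → Fin n → Bool
both x x′ z = (z =ᶠ x) ∨ (z =ᶠ x′)

both-cases : (x x′ : Fin n) {z : Fin n} → both x x′ z ≡ true → z ≡ x ⊎ z ≡ x′
both-cases x x′ {z} e with dichotomy (z =ᶠ x)
... | inj₁ p = inj₁ (=ᶠ⇒≡ p)
... | inj₂ p = inj₂ (=ᶠ⇒≡ (trans (sym (cong (_∨ (z =ᶠ x′)) p)) e))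

both-fst : (x x′ : Fin n) → both x x′ x ≡ true
both-fst x x′ rewrite =ᶠ-refl x = refl

both-snd : (x x′ : Fin n) → both x x′ x′ ≡ true
both-snd x x′ rewrite =ᶠ-refl x′ = Bool.∨-zeroʳ _

both-none : {x x′ z : Fin n} → z ≢ x → z ≢ x′ → both x x′ z ≡ false
both-none ≢x ≢x′ rewrite =ᶠ-≢ ≢x | =ᶠ-≢ ≢x′ = refl

module _ (G : Graph n) (X : Fin n → Bool) where

  private
    In Out : Fin n → Set
    In x  = X x ≡ true
    Out x = X x ≡ false

  -- Two elements of an independent family would have nonzero, distinct rows; over GF(2) these are
  -- not proportional, so some minor would not vanish.
  Cut⇒CutRank≤1 : Cut G In Out → CutRank≤ G X 1
  Cut⇒CutRank≤1 c S (S⊆X , indep) with count-one S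
  ... | inj₁ ≤1 = ≤1
  ... | inj₂ (x , x′ , x≢ , sx , sx′) = clash
      (indep (_=ᶠ x) (λ z e → subst (λ z → S z ≡ true) (sym (=ᶠ⇒≡ e)) sx) (x , =ᶠ-refl x))
      (indep (_=ᶠ x′) (λ z e → subst (λ z → S z ≡ true) (sym (=ᶠ⇒≡ e)) sx′) (x′ , =ᶠ-refl x′))
      (indep (both x x′) (λ z e → [ (λ { refl → sx }) , (λ { refl → sx′ }) ]′ (both-cases x x′ {z} e)) (x , both-fst x x′))
    where
    single : ∀ u y → parity (λ z → (z =ᶠ u) ∧ adj G z y) ≡ adj G u y
    single u y = trans (parity-one (λ z → (z =ᶠ u) ∧ adj G z y) u λ z z≢ → cong (_∧ adj G z y) (=ᶠ-≢ z≢))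
      (cong (_∧ adj G u y) (=ᶠ-refl u))
    double : ∀ y → parity (λ z → both x x′ z ∧ adj G z y) ≡ adj G x y xor adj G x′ y
    double y = trans (parity-two (λ z → both x x′ z ∧ adj G z y) x x′ x≢ λ z p q → cong (_∧ adj G z y) (both-none p q))
      (cong₂ _xor_ (cong (_∧ adj G x y) (both-fst x x′)) (cong (_∧ adj G x′ y) (both-snd x x′)))
    impossible : ∀ a b → b ≡ a ∧ true → a xor b ≡ true → ⊥
    impossible true  .true  refl ()
    impossible false .false refl ()
    clash : ∃[ y ] (Out y × parity (λ z → (z =ᶠ x) ∧ adj G z y) ≡ true) →
      ∃[ y ] (Out y × parity (λ z → (z =ᶠ x′) ∧ adj G z y) ≡ true) →
      ∃[ y ] (Out y × parity (λ z → both x x′ z ∧ adj G z y) ≡ true) → count S ≤ 1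
    clash (y₁ , o₁ , e₁) (y₂ , o₂ , e₂) (y₃ , o₃ , e₃) = ⊥-elim (impossible (adj G x y₃) (adj G x′ y₃)
      (trans (sym (cong (_∧ adj G x′ y₃) xy₁)) (trans (c (S⊆X x sx) (S⊆X x′ sx′) o₁ o₃) (cong (adj G x y₃ ∧_) x′y₁)))
      (trans (sym (double y₃)) e₃))
      where
      xy₁ : adj G x y₁ ≡ true
      xy₁ = trans (sym (single x y₁)) e₁
      x′y₁ : adj G x′ y₁ ≡ true
      x′y₁ = proj₂ (∧-true (trans (sym (c (S⊆X x sx) (S⊆X x′ sx′) o₁ o₂)) (cong₂ _∧_ xy₁ (trans (sym (single x′ y₂)) e₂))))

  -- A nonzero combination of the rows of a nonsingular 2 × 2 matrix is nonzero.
  nonsingular : ∀ a b c d p q → ¬ (a ∧ d ≡ b ∧ c) → p ∨ q ≡ true →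
    (p ∧ a) xor (q ∧ c) ≡ true ⊎ (p ∧ b) xor (q ∧ d) ≡ true
  nonsingular = from-yes (∀? λ a → ∀? λ b → ∀? λ c → ∀? λ d → ∀? λ p → ∀? λ q →
    ¬? (a ∧ d Bool.≟ b ∧ c) →-dec (p ∨ q Bool.≟ true) →-dec
    (((p ∧ a) xor (q ∧ c) Bool.≟ true) ⊎-dec ((p ∧ b) xor (q ∧ d) Bool.≟ true)))

  -- The rows `x`, `x′` of a minor that does not vanish form an independent family of size 2.
  CutRank≤1⇒Cut : CutRank≤ G X 1 → Cut G In Out
  CutRank≤1⇒Cut r {x} {x′} {y} {y′} ix ix′ oy oy′ with adj G x y ∧ adj G x′ y′ Bool.≟ adj G x y′ ∧ adj G x′ y
  ... | yes e = e
  ... | no regular = contradiction (r (both x x′) (within , indep)) (ℕ.<⇒≱ (count-two (both x x′) x≢x′ (both-fst x x′) (both-snd x x′)))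
    where
    x≢x′ : x ≢ x′
    x≢x′ refl = regular (Bool.∧-comm (adj G x y) _)
    within : both x x′ ⊆ᵇ X
    within z e = [ (λ { refl → ix }) , (λ { refl → ix′ }) ]′ (both-cases x x′ {z} e)
    combine : ∀ U → U ⊆ᵇ both x x′ → ∀ u → parity (λ z → U z ∧ adj G z u) ≡ (U x ∧ adj G x u) xor (U x′ ∧ adj G x′ u)
    combine U U⊆ u = parity-two _ x x′ x≢x′
      λ z p q → cong (_∧ adj G z u) (Bool.¬-not λ e → true≢false (U⊆ z e) (both-none p q))
    indep : ∀ U → U ⊆ᵇ both x x′ → (∃[ z ] U z ≡ true) → ∃[ u ] (Out u × parity (λ z → U z ∧ adj G z u) ≡ true)
    indep U U⊆ (z , uz) with nonsingular (adj G x y) (adj G x y′) (adj G x′ y) (adj G x′ y′) (U x) (U x′) regular nonempty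
      where
      nonempty : U x ∨ U x′ ≡ true
      nonempty with both-cases x x′ {z} (U⊆ z uz)
      ... | inj₁ refl = cong (_∨ U x′) uz
      ... | inj₂ refl = trans (cong (U x ∨_) uz) (Bool.∨-zeroʳ (U x))
    ... | inj₁ e = y  , oy  , trans (combine U U⊆ y) e
    ... | inj₂ e = y′ , oy′ , trans (combine U U⊆ y′) e

-- From layouts to linear rank-decompositions

index-take : {A : Set} {x : A} {l : List A} {j : ℕ} (p : x ∈ l) → toℕ (index p) < j → x ∈ take j l
index-take {j = suc j} (here refl) _         = here refl
index-take {j = suc j} (there p)   (s≤s i<j) = there (index-take p i<j)

index-drop : {A : Set} {x : A} {l : List A} {j : ℕ} (p : x ∈ l) → j ≤ toℕ (index p) → x ∈ drop j l
index-drop {j = zero}  p         _         = p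
index-drop {j = suc j} (there p) (s≤s j≤i) = index-drop p j≤i

<ᵇ-true : ∀ {i j} → (i <ᵇ j) ≡ true → i < j
<ᵇ-true {i} {j} e = ℕ.<ᵇ⇒< i j (subst T (sym e) tt)

<ᵇ-false : ∀ {i j} → (i <ᵇ j) ≡ false → j ≤ i
<ᵇ-false {i} {j} e = ℕ.≮⇒≥ λ i<j → subst T e (ℕ.<⇒<ᵇ i<j)

lookup-injective : {A : Set} {l : List A} → Unique l → ∀ i j → lookup l i ≡ lookup l j → i ≡ j
lookup-injective (p ∷ u) zero    zero    e = refl
lookup-injective {l = _ ∷ l} (p ∷ u) zero    (suc j) e = contradiction e (All.lookup p (∈-lookup {xs = l} j))
lookup-injective {l = _ ∷ l} (p ∷ u) (suc i) zero    e = contradiction (sym e) (All.lookup p (∈-lookup {xs = l} i))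
lookup-injective (p ∷ u) (suc i) (suc j) e = cong suc (lookup-injective u i j e)

module _ (G : Graph n) (zs : List (Fin n)) (perm : zs ↭ allFin n) (lin : Lin G zs) where

  private
    len : length zs ≡ n
    len = trans (Perm.↭-length perm) (List.length-tabulate id)
    mem : ∀ x → x ∈ zs
    mem x = Perm.∈-resp-↭ (↭-sym perm) (∈-allFin x)
    to : Fin n → Fin n
    to i = lookup zs (Fin.cast (sym len) i)
    from : Fin n → Fin n
    from x = Fin.cast len (index (mem x))

    to-from : ∀ x → to (from x) ≡ x
    to-from x = trans (cong (lookup zs) (trans (Fin.cast-trans len (sym len) _) (Fin.cast-is-id _ _))) (sym (Any.lookup-index (mem x)))
    from-to : ∀ i → from (to i) ≡ i
    from-to i = trans (cong (Fin.cast len) (lookup-injective (Unique-resp-↭ (↭-sym perm) (Unique.allFin⁺ n)) _ _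
      (sym (Any.lookup-index (mem (to i)))))) (trans (Fin.cast-trans (sym len) len i) (Fin.cast-is-id _ i))

    σ : Fin n ↔ Fin n
    σ = mk↔ₛ′ to from to-from from-to

  Lin⇒LinRankWidth≤1 : LinRankWidth≤ G 1
  Lin⇒LinRankWidth≤1 with ℕ.≤-total n 1
  ... | inj₁ n≤1 = inj₁ n≤1
  ... | inj₂ 1≤n with n ℕ.≟ 1
  ... | yes refl = inj₁ ℕ.≤-refl
  ... | no n≢1 = inj₂ (ℕ.≤∧≢⇒< 1≤n (n≢1 ∘ sym) , σ , leaf-edges , spine-edges)
    where
    leaf-edges : ∀ v → CutRank≤ G (singletonSet v) 1
    leaf-edges v = Cut⇒CutRank≤1 G (singletonSet v) (Cut-multiples G v λ e → inj₂ λ {y} _ → cong (λ x → adj G x y) (=ᶠ⇒≡ e))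
    position : ∀ x → toℕ (from x) ≡ toℕ (index (mem x))
    position x = Fin.toℕ-cast len _
    spine-edges : ∀ j → 1 ≤ j → j < n → CutRank≤ G (prefixSet σ j) 1
    spine-edges j _ _ = Cut⇒CutRank≤1 G (prefixSet σ j)
      (Cut-⊆ˡ G {T = λ x → prefixSet σ j x ≡ false} (λ {x} e → index-take (mem x) (subst (_< j) (position x) (<ᵇ-true e)))
      (Cut-⊆ʳ G {S = _∈ take j zs} (λ {x} e → index-drop (mem x) (subst (j ≤_) (position x) (<ᵇ-false e)))
        (lin (take j zs) (drop j zs) (List.take++drop≡id j zs))))

-- Linear rank-width at most 1 in terms of vertex positions; unlike Lin, it passes to vertex-minors by restricting pos.
Ordered : Graph n → (Fin n → ℕ) → Set
Ordered G pos = ∀ j → Cut G (λ x → pos x < j) (λ y → j ≤ pos y)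

Ordered-lcs : {G : Graph n} {pos : Fin n → ℕ} (ws : List (Fin n)) → Ordered G pos → Ordered (lcs G ws) pos
Ordered-lcs []       o = o
Ordered-lcs {G = G} {pos} (w ∷ ws) o = Ordered-lcs ws λ j →
  Cut-lc G {λ x → pos x < j} {λ y → j ≤ pos y} (λ p q → ℕ.<⇒≱ p q) (ℕ.<-≤-connex (pos w) j) (o j)

Ordered-VM : {G : Graph m} {H : Graph n} {pos : Fin m → ℕ} → Ordered G pos → (minor : VM G H) → Ordered H (pos ∘ VM.embed minor)
Ordered-VM o (vm ws f _ e) j {x} {x′} {y} {y′} sx sx′ ty ty′ = trans (cong₂ _∧_ (e x y) (e x′ y′))
  (trans (Ordered-lcs ws o j sx sx′ ty ty′) (sym (cong₂ _∧_ (e x y′) (e x′ y))))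

DecompWidth⇒Ordered : {G : Graph n} (σ : Fin n ↔ Fin n) → DecompWidth≤ G σ 1 → Ordered G (toℕ ∘ Inverse.from σ)
-- The decomposition bounds the prefixes with 1 ≤ j < n only; for j = 0 and j ≥ n one side is empty
-- and the claim is vacuous.
DecompWidth⇒Ordered {n} {G} σ (_ , width) zero () 
DecompWidth⇒Ordered {n} {G} σ (_ , width) (suc j) sx sx′ ty ty′ with suc j ℕ.<? n
... | no  ≥n = contradiction (ℕ.<-≤-trans (Fin.toℕ<n _) (ℕ.≮⇒≥ ≥n)) (ℕ.≤⇒≯ ty)
... | yes <n = CutRank≤1⇒Cut G (prefixSet σ (suc j)) (width (suc j) (s≤s z≤n) <n) (below sx) (below sx′) (above ty) (above ty′)
  where
  below : ∀ {i} → i < suc j → (i <ᵇ suc j) ≡ true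
  below {i} i<j with dichotomy (i <ᵇ suc j)
  ... | inj₁ e = e
  ... | inj₂ e = contradiction (<ᵇ-false {i} e) (ℕ.<⇒≱ i<j)
  above : ∀ {i} → suc j ≤ i → (i <ᵇ suc j) ≡ false
  above {i} j≤i with dichotomy (i <ᵇ suc j)
  ... | inj₂ e = e
  ... | inj₁ e = contradiction (<ᵇ-true {i} e) (ℕ.≤⇒≯ j≤i)

-- The natural order of a path

Path-crossing : ∀ {k j} {x y : Fin k} → toℕ x < j → j ≤ toℕ y → pathAdj x y ≡ true → suc (toℕ x) ≡ j × toℕ y ≡ j
Path-crossing {x = x} {y} x<j j≤y e with dichotomy (suc (toℕ x) ≡ᵇ toℕ y)
... | inj₁ p =
  ℕ.≤-antisym x<j (ℕ.≤-trans j≤y (ℕ.≤-reflexive (sym q))) , ℕ.≤-antisym (ℕ.≤-trans (ℕ.≤-reflexive (sym q)) x<j) j≤y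
  where
  q : suc (toℕ x) ≡ toℕ y
  q = ℕ.≡ᵇ⇒≡ _ _ (subst T (sym p) tt)
... | inj₂ p = ⊥-elim (ℕ.<-irrefl refl (ℕ.<-trans (ℕ.<-≤-trans x<j j≤y)
  (ℕ.≤-reflexive (ℕ.≡ᵇ⇒≡ (suc (toℕ y)) _ (subst T (sym (trans (sym (cong (_∨ (suc (toℕ y) ≡ᵇ toℕ x)) p)) e)) tt)))))

Path-crossing-unique : ∀ {k j} {x x′ y y′ : Fin k} → toℕ x < j → toℕ x′ < j → j ≤ toℕ y → j ≤ toℕ y′ →
  pathAdj x y ∧ pathAdj x′ y′ ≡ true → x ≡ x′ × y ≡ y′
Path-crossing-unique sx sx′ ty ty′ e with ∧-true e
... | e₁ , e₂ with Path-crossing sx ty e₁ | Path-crossing sx′ ty′ e₂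
... | p , q | p′ , q′ = Fin.toℕ-injective (ℕ.suc-injective (trans p (sym p′))) , Fin.toℕ-injective (trans q (sym q′))

-- At most one edge of the path crosses a cut, so two crossing entries with product 1 coincide, and
-- then the minor is trivial.
Path-Ordered : (k : ℕ) → Ordered (Path k) toℕ
Path-Ordered k j {x} {x′} {y} {y′} sx sx′ ty ty′ with dichotomy (pathAdj x y ∧ pathAdj x′ y′) | dichotomy (pathAdj x y′ ∧ pathAdj x′ y)
... | inj₂ e | inj₂ e′ = trans e (sym e′)
... | inj₁ e | _ with Path-crossing-unique sx sx′ ty ty′ e
... | refl , refl = refl
Path-Ordered k j {x} {x′} {y} {y′} sx sx′ ty ty′ | inj₂ _ | inj₁ e′ with Path-crossing-unique sx sx′ ty′ ty e′
... | refl , refl = refl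

-- Small graphs without a linear layout

count-cong : {f g : Fin n → Bool} → (∀ x → f x ≡ g x) → count f ≡ count g
count-cong {zero}  e = refl
count-cong {suc n} {f} {g} e = cong₂ (λ b c → (if b then 1 else 0) + c) (e zero) (count-cong (e ∘ suc))

count-all : (f : Fin n → Bool) → (∀ x → f x ≡ true) → count f ≡ n
count-all {zero}  f e = refl
count-all {suc n} f e rewrite e zero = cong suc (count-all (f ∘ suc) (e ∘ suc))

below : (Fin n → ℕ) → ℕ → Fin n → Bool
below pos j x = pos x <ᵇ j

<ᵇ-suc : ∀ {i j} → i ≢ j → (i <ᵇ suc j) ≡ (i <ᵇ j)
<ᵇ-suc {zero}  {zero}  i≢j = contradiction refl i≢j
<ᵇ-suc {zero}  {suc j} i≢j = refl
<ᵇ-suc {suc i} {zero}  i≢j = refl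
<ᵇ-suc {suc i} {suc j} i≢j = <ᵇ-suc {i} {j} (i≢j ∘ cong suc)

count-below-suc : (pos : Fin n → ℕ) → (∀ {x y} → pos x ≡ pos y → x ≡ y) → ∀ j →
  count (below pos (suc j)) ≤ suc (count (below pos j))
count-below-suc {zero}  pos inj j = z≤n
count-below-suc {suc n} pos inj j with pos zero ℕ.≟ j
... | yes refl = ℕ.≤-trans (ℕ.+-monoˡ-≤ _ (bit≤1 (below pos (suc j) zero)))
    (s≤s (ℕ.≤-trans (ℕ.≤-reflexive (count-cong λ x → <ᵇ-suc {pos (suc x)} {j} λ e → case inj e of λ ()))
      (ℕ.m≤n+m _ (if below pos j zero then 1 else 0))))
  where
  bit≤1 : ∀ b → (if b then 1 else 0) ≤ 1
  bit≤1 true  = ℕ.≤-refl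
  bit≤1 false = z≤n
... | no ≢ = ℕ.≤-trans (ℕ.+-mono-≤ (ℕ.≤-reflexive (cong (λ b → if b then 1 else 0) (<ᵇ-suc {pos zero} {j} ≢)))
    (count-below-suc (pos ∘ suc) (Fin.suc-injective ∘ inj) j)) (ℕ.≤-reflexive (ℕ.+-suc _ _))

bounded : (f : Fin n → ℕ) → ∃ λ b → ∀ x → f x < b
bounded {zero}  f = 0 , λ ()
bounded {suc n} f with bounded (f ∘ suc)
... | b , <b = suc (f zero) + b , λ
  { zero    → ℕ.m≤m+n _ _
  ; (suc x) → ℕ.<-≤-trans (<b x) (ℕ.m≤n+m b _) }

-- The sets below pos j grow by at most one vertex at a time, hence have every size up to n.
exists-below : (pos : Fin n → ℕ) → (∀ {x y} → pos x ≡ pos y → x ≡ y) → ∀ {k} → k ≤ n → ∃ λ j → count (below pos j) ≡ k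
exists-below {n} pos inj {k} k≤n with bounded pos
... | b , <b = search-up b (ℕ.≤-trans k≤n (ℕ.≤-reflexive (sym (count-all _ λ x → all-below (<b x)))))
  where
  all-below : ∀ {i j} → i < j → (i <ᵇ j) ≡ true
  all-below {i} {j} i<j with dichotomy (i <ᵇ j)
  ... | inj₁ e = e
  ... | inj₂ e = contradiction (<ᵇ-false {i} e) (ℕ.<⇒≱ i<j)
  none-below : ∀ {m} (f : Fin m → ℕ) → count (below f 0) ≡ 0
  none-below {zero}  f = refl
  none-below {suc m} f = none-below (f ∘ suc)
  search-up : ∀ b → k ≤ count (below pos b) → ∃ λ j → count (below pos j) ≡ k
  search-up zero k≤ = 0 , trans (none-below pos) (sym (ℕ.n≤0⇒n≡0 (subst (k ≤_) (none-below pos) k≤)))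
  search-up (suc b) k≤ with k ℕ.≤? count (below pos b)
  ... | yes p = search-up b p
  ... | no ¬p = suc b , ℕ.≤-antisym (ℕ.≤-trans (count-below-suc pos inj b) (ℕ.≰⇒> ¬p)) k≤

-- Subsets are encoded as Boolean vectors, over which quantification is decidable by enumeration.
∀Vec? : ∀ n {P : Vec Bool n → Set} → (∀ v → Dec (P v)) → Dec (∀ v → P v)
∀Vec? zero P? with P? []
... | yes p = yes λ { [] → p }
... | no ¬p = no λ f → ¬p (f [])
∀Vec? (suc n) {P} P? with ∀? {λ b → ∀ v → P (b ∷ v)} (λ b → ∀Vec? n (λ v → P? (b ∷ v)))
... | yes f = yes λ { (b ∷ v) → f b v }
... | no ¬f = no λ f → ¬f λ b v → f (b ∷ v)

Rank≥2 : Graph n → (Fin n → Bool) → Set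
Rank≥2 G X = ∃ λ x → X x ≡ true × ∃ λ x′ → X x′ ≡ true × ∃ λ y → X y ≡ false × ∃ λ y′ → X y′ ≡ false ×
  adj G x y ∧ adj G x′ y′ ≢ adj G x y′ ∧ adj G x′ y

rank≥2? : (G : Graph n) (X : Fin n → Bool) → Dec (Rank≥2 G X)
rank≥2? G X = Fin.any? λ x → (X x Bool.≟ true) ×-dec Fin.any? λ x′ → (X x′ Bool.≟ true) ×-dec
  Fin.any? λ y → (X y Bool.≟ false) ×-dec Fin.any? λ y′ → (X y′ Bool.≟ false) ×-dec
  ¬? (adj G x y ∧ adj G x′ y′ Bool.≟ adj G x y′ ∧ adj G x′ y)

Unsplittable : ℕ → Graph n → Set
Unsplittable k G = ∀ v → count (Vec.lookup v) ≡ k → Rank≥2 G (Vec.lookup v)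

unsplittable? : ∀ k (G : Graph n) → Dec (Unsplittable k G)
unsplittable? {n} k G = ∀Vec? n λ v → (count (Vec.lookup v) ℕ.≟ k) →-dec rank≥2? G (Vec.lookup v)

C5-unsplittable : Unsplittable 2 C5
C5-unsplittable = from-yes (unsplittable? 2 C5)

N-unsplittable : Unsplittable 3 N
N-unsplittable = from-yes (unsplittable? 3 N)

Q-unsplittable : Unsplittable 3 Q
Q-unsplittable = from-yes (unsplittable? 3 Q)

-- Whatever the order, some initial segment has exactly `k` vertices, so a single size refutes all
-- orders at once.
unsplittable⇒¬Ordered : ∀ {k} {G : Graph n} → k ≤ n → Unsplittable k G →
  (pos : Fin n → ℕ) → (∀ {x y} → pos x ≡ pos y → x ≡ y) → ¬ Ordered G pos
unsplittable⇒¬Ordered {G = G} k≤n uns pos inj o with exists-below pos inj k≤n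
... | j , e with uns (Vec.tabulate (below pos j)) (trans (count-cong (Vec.lookup∘tabulate (below pos j))) e)
... | x , p , x′ , p′ , y , q , y′ , q′ , minor = minor (o j
  (<ᵇ-true (trans (sym (Vec.lookup∘tabulate _ x)) p)) (<ᵇ-true (trans (sym (Vec.lookup∘tabulate _ x′)) p′))
  (<ᵇ-false (trans (sym (Vec.lookup∘tabulate _ y)) q)) (<ᵇ-false (trans (sym (Vec.lookup∘tabulate _ y′)) q′)))

Ordered⇒¬VM : ∀ {k} {G : Graph m} {H : Graph n} {pos : Fin m → ℕ} → (∀ {x y} → pos x ≡ pos y → x ≡ y) → Ordered G pos →
  k ≤ n → Unsplittable k H → ¬ VM G H
Ordered⇒¬VM {G = G} {H} {pos} inj o k≤n uns minor =
  unsplittable⇒¬Ordered {G = H} k≤n uns (pos ∘ VM.embed minor) (VM.injective minor ∘ inj) (Ordered-VM {G = G} {H} o minor)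

Excluded : Graph n → Set
Excluded G = ¬ HasVertexMinor G C5 × ¬ HasVertexMinor G N × ¬ HasVertexMinor G Q

Ordered⇒Excluded : {G : Graph n} {pos : Fin n → ℕ} → (∀ {x y} → pos x ≡ pos y → x ≡ y) → Ordered G pos → Excluded G
Ordered⇒Excluded {G = G} inj o =
  Ordered⇒¬VM {G = G} {C5} inj o (s≤s (s≤s z≤n)) C5-unsplittable ∘ HasVertexMinor⇒VM ,
  Ordered⇒¬VM {G = G} {N} inj o (s≤s (s≤s (s≤s z≤n))) N-unsplittable ∘ HasVertexMinor⇒VM ,
  Ordered⇒¬VM {G = G} {Q} inj o (s≤s (s≤s (s≤s z≤n))) Q-unsplittable ∘ HasVertexMinor⇒VM

-- Realization inside a path

-- Adjacency and local complementation on the vertex set ℕ, so that the number of path vertices need not be fixed in advance.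
pathℕ : ℕ → ℕ → Bool
pathℕ i j = (suc i ≡ᵇ j) ∨ (suc j ≡ᵇ i)

lcℕ : (ℕ → ℕ → Bool) → ℕ → ℕ → ℕ → Bool
lcℕ A w i j = A i j xor (A i w ∧ A j w ∧ not (i ≡ᵇ j))

lcsℕ : List ℕ → ℕ → ℕ → Bool
lcsℕ []       = pathℕ
lcsℕ (w ∷ ws) = lcℕ (lcsℕ ws) w

≡ᵇ-refl : ∀ i → (i ≡ᵇ i) ≡ true
≡ᵇ-refl zero    = refl
≡ᵇ-refl (suc i) = ≡ᵇ-refl i

≡ᵇ-≢ : ∀ {i j} → i ≢ j → (i ≡ᵇ j) ≡ false
≡ᵇ-≢ {i} {j} i≢j with dichotomy (i ≡ᵇ j)
... | inj₁ e = contradiction (ℕ.≡ᵇ⇒≡ i j (subst T (sym e) tt)) i≢j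
... | inj₂ e = e

lcsℕ-sym : ∀ ws i j → lcsℕ ws i j ≡ lcsℕ ws j i
lcsℕ-sym []       i j = Bool.∨-comm (suc i ≡ᵇ j) _
lcsℕ-sym (w ∷ ws) i j = trans (lc-sym _ _ (lcsℕ ws i w) (lcsℕ ws j w) (i ≡ᵇ j) (lcsℕ-sym ws i j))
  (cong (λ e → lcsℕ ws j i xor (lcsℕ ws j w ∧ lcsℕ ws i w ∧ not e)) (≡ᵇ-sym i j))

lcsℕ-irrefl : ∀ ws i → lcsℕ ws i i ≡ false
lcsℕ-irrefl []       i = cong₂ _∨_ (sucᵇ-irr i) (sucᵇ-irr i)
lcsℕ-irrefl (w ∷ ws) i = trans (cong (λ e → lcsℕ ws i i xor (lcsℕ ws i w ∧ lcsℕ ws i w ∧ not e)) (≡ᵇ-refl i))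
  (lc-irr _ (lcsℕ ws i w) (lcsℕ-irrefl ws i))

path-far : ∀ {i j} → suc i < j → pathℕ i j ≡ false
path-far {i} {j} i<j rewrite ≡ᵇ-≢ (ℕ.<⇒≢ i<j) = ≡ᵇ-≢ {suc j} {i} (ℕ.<⇒≢ (ℕ.m<n⇒m<1+n (ℕ.<-trans ℕ.≤-refl i<j)) ∘ sym)

path-next : ∀ i → pathℕ i (suc i) ≡ true
path-next i rewrite ≡ᵇ-refl i = refl

-- By induction `c` is adjacent to none of the centres, all at least two steps away, so no
-- complementation affects it.
lcsℕ-before : ∀ {c} ws → All (λ w → suc (suc c) ≤ w) ws → ∀ j → lcsℕ ws c j ≡ pathℕ c j
lcsℕ-before []       []       j = refl
lcsℕ-before {c} (w ∷ ws) (p ∷ ps) j = trans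
  (cong (λ b → lcsℕ ws c j xor (b ∧ lcsℕ ws j w ∧ not (c ≡ᵇ j))) (trans (lcsℕ-before ws ps w) (path-far p)))
  (trans (Bool.xor-identityʳ _) (lcsℕ-before ws ps j))

-- After local complementation at ws, the path on ℕ contains G restricted to t ∷ l as an induced subgraph, with t at position e.
-- The part of the path from e onwards is intact and attached only at e. Positions below c are not used.
record Realized (c : ℕ) (G : Graph n) (t : Fin n) (l : List (Fin n)) : Set where
  constructor realized
  field
    e      : ℕ
    ws     : List ℕ
    f      : Fin n → ℕ
    f-t    : f t ≡ e
    c≤e    : c ≤ e
    f-l    : ∀ {x} → x ∈ l → c ≤ f x × f x < e
    c≤ws   : All (c ≤_) ws
    agrees : ∀ {x y} → x ∈ t ∷ l → y ∈ t ∷ l → lcsℕ ws (f x) (f y) ≡ adj G x y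
    inj    : ∀ {x y} → x ∈ t ∷ l → y ∈ t ∷ l → f x ≡ f y → x ≡ y
    unattached   : ∀ {x j} → x ∈ l → e < j → lcsℕ ws (f x) j ≡ false
    intact : ∀ {i j} → e ≤ i → e ≤ j → lcsℕ ws i j ≡ pathℕ i j

_[_↦_] : (Fin n → ℕ) → Fin n → ℕ → Fin n → ℕ
(f [ x ↦ k ]) y with y Fin.≟ x
... | yes _ = k
... | no  _ = f y

update-at : (f : Fin n → ℕ) (x : Fin n) (k : ℕ) → (f [ x ↦ k ]) x ≡ k
update-at f x k with x Fin.≟ x
... | yes _ = refl
... | no  ≢ = contradiction refl ≢

update-off : (f : Fin n → ℕ) {x y : Fin n} (k : ℕ) → y ≢ x → (f [ x ↦ k ]) y ≡ f y
update-off f {x} {y} k y≢x with y Fin.≟ x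
... | yes e = contradiction e y≢x
... | no  _ = refl

Realized-cong : ∀ {c} {G H : Graph n} {t l} → (∀ x y → adj G x y ≡ adj H x y) → Realized c G t l → Realized c H t l
Realized-cong e r = record { Realized r ; agrees = λ x∈ y∈ → trans (Realized.agrees r x∈ y∈) (e _ _) }

module _ {c : ℕ} {G : Graph n} {t : Fin n} {l : List (Fin n)} (u : Unique (t ∷ l)) (r : Realized c G t l) where

  open Realized r

  private
    t≢ : ∀ {x} → x ∈ l → t ≢ x
    t≢ x∈ = All.lookup (AllPairs.head u) x∈

    f≤e : ∀ {x} → x ∈ t ∷ l → f x ≤ e
    f≤e (here refl) = ℕ.≤-reflexive f-t
    f≤e (there x∈)  = ℕ.<⇒≤ (proj₂ (f-l x∈))

    same-test : ∀ {x y} → x ∈ t ∷ l → y ∈ t ∷ l → (f x ≡ᵇ f y) ≡ (x =ᶠ y)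
    same-test {x} {y} x∈ y∈ with x Fin.≟ y
    ... | yes refl = trans (≡ᵇ-refl (f x)) (sym (=ᶠ-refl x))
    ... | no  x≢y  = trans (≡ᵇ-≢ (x≢y ∘ inj x∈ y∈)) (sym (=ᶠ-≢ x≢y))

    complement : ∀ {w x y} → w ∈ t ∷ l → x ∈ t ∷ l → y ∈ t ∷ l → lcsℕ (f w ∷ ws) (f x) (f y) ≡ adj (G * w) x y
    complement w∈ x∈ y∈ = cong₂ _xor_ (agrees x∈ y∈) (cong₂ _∧_ (agrees x∈ w∈)
      (cong₂ (λ a b → a ∧ not b) (agrees y∈ w∈) (same-test x∈ y∈)))

  -- Beyond `e` nothing is adjacent to `f w`, so no pair of positions from `e` onwards is toggled.
  Realized-lc-inner : ∀ {w} → w ∈ l → Realized c (G * w) t l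
  Realized-lc-inner {w} w∈ = record
    { e = e ; ws = f w ∷ ws ; f = f ; f-t = f-t ; c≤e = c≤e ; f-l = f-l ; c≤ws = proj₁ (f-l w∈) ∷ c≤ws
    ; agrees = complement (there w∈) ; inj = inj
    ; unattached = λ {x} {j} x∈ e<j → trans (cong₂ (λ a b → a xor (lcsℕ ws (f x) (f w) ∧ b ∧ not (f x ≡ᵇ j)))
        (unattached x∈ e<j) (beyond e<j)) (Bool.∧-zeroʳ _)
    ; intact = λ {i} {j} e≤i e≤j → trans (keep e≤i e≤j) (intact e≤i e≤j) }
    where
    beyond : ∀ {j} → e < j → lcsℕ ws j (f w) ≡ false
    beyond {j} e<j = trans (lcsℕ-sym ws j (f w)) (unattached w∈ e<j)
    keep : ∀ {i j} → e ≤ i → e ≤ j → lcsℕ (f w ∷ ws) i j ≡ lcsℕ ws i j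
    keep {i} {j} e≤i e≤j with ℕ.m≤n⇒m<n∨m≡n e≤i | ℕ.m≤n⇒m<n∨m≡n e≤j
    ... | inj₁ e<i | _ = trans (cong (λ b → lcsℕ ws i j xor (b ∧ lcsℕ ws j (f w) ∧ not (i ≡ᵇ j))) (beyond e<i)) (Bool.xor-identityʳ _)
    ... | inj₂ refl | inj₁ e<j = trans (cong (λ b → lcsℕ ws e j xor (lcsℕ ws e (f w) ∧ b ∧ not (e ≡ᵇ j))) (beyond e<j))
      (trans (cong (lcsℕ ws e j xor_) (Bool.∧-zeroʳ _)) (Bool.xor-identityʳ _))
    ... | inj₂ refl | inj₂ refl = trans (lcsℕ-irrefl (f w ∷ ws) e) (sym (lcsℕ-irrefl ws e))

  -- Complementing at position e makes e + 1 adjacent to the neighbours of t, so e + 1 takes over the role of t.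
  Realized-lc-last : Realized c (G * t) t l
  Realized-lc-last = record
    { e = suc e ; ws = e ∷ ws ; f = f [ t ↦ suc e ] ; f-t = update-at f t (suc e) ; c≤e = ℕ.m≤n⇒m≤1+n c≤e
    ; f-l = λ x∈ → subst (λ i → c ≤ i × i < suc e) (sym (old x∈)) (proj₁ (f-l x∈) , ℕ.m≤n⇒m≤1+n (proj₂ (f-l x∈)))
    ; c≤ws = c≤e ∷ c≤ws ; agrees = agrees′ ; inj = inj′
    ; unattached = λ {x} {j} x∈ e<j → trans (cong (λ i → lcsℕ (e ∷ ws) i j) (old x∈)) (trans
        (cong₂ (λ a b → a xor (lcsℕ ws (f x) e ∧ b ∧ not (f x ≡ᵇ j))) (unattached x∈ (ℕ.<-trans ℕ.≤-refl e<j))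
          (trans (lcsℕ-sym ws j e) (trans (intact ℕ.≤-refl (ℕ.<⇒≤ (ℕ.<-trans ℕ.≤-refl e<j))) (path-far e<j)))) (Bool.∧-zeroʳ _))
    ; intact = intact′ }
    where
    old : ∀ {x} → x ∈ l → (f [ t ↦ suc e ]) x ≡ f x
    old x∈ = update-off f (suc e) (t≢ x∈ ∘ sym)
    next : lcsℕ ws (suc e) e ≡ true
    next = trans (lcsℕ-sym ws (suc e) e) (trans (intact ℕ.≤-refl (ℕ.n≤1+n e)) (path-next e))
    to-next : ∀ {x} → x ∈ l → lcsℕ (e ∷ ws) (f x) (suc e) ≡ adj (G * t) x t
    to-next {x} x∈ = begin
      lcsℕ ws (f x) (suc e) xor (lcsℕ ws (f x) e ∧ lcsℕ ws (suc e) e ∧ not (f x ≡ᵇ suc e))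
        ≡⟨ cong (_xor (lcsℕ ws (f x) e ∧ lcsℕ ws (suc e) e ∧ not (f x ≡ᵇ suc e))) (unattached x∈ ℕ.≤-refl) ⟩
      lcsℕ ws (f x) e ∧ lcsℕ ws (suc e) e ∧ not (f x ≡ᵇ suc e)
        ≡⟨ cong₂ (λ a b → lcsℕ ws (f x) e ∧ a ∧ not b) next (≡ᵇ-≢ (ℕ.<⇒≢ (ℕ.m≤n⇒m≤1+n (proj₂ (f-l x∈))))) ⟩
      lcsℕ ws (f x) e ∧ true     ≡⟨ Bool.∧-identityʳ _ ⟩
      lcsℕ ws (f x) e            ≡⟨ cong (lcsℕ ws (f x)) f-t ⟨
      lcsℕ ws (f x) (f t)        ≡⟨ agrees (there x∈) (here refl) ⟩
      adj G x t                  ≡⟨ lc-centreʳ G t x ⟨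
      adj (G * t) x t            ∎
      where open ≡-Reasoning
    agrees′ : ∀ {x y} → x ∈ t ∷ l → y ∈ t ∷ l →
      lcsℕ (e ∷ ws) ((f [ t ↦ suc e ]) x) ((f [ t ↦ suc e ]) y) ≡ adj (G * t) x y
    agrees′ (here refl) (here refl) = trans (lcsℕ-irrefl (e ∷ ws) _) (sym (adj-irrefl (G * t) t))
    agrees′ {x} (there x∈) (here refl) =
      trans (cong₂ (lcsℕ (e ∷ ws)) (old x∈) (update-at f t (suc e))) (to-next x∈)
    agrees′ {y = y} (here refl) (there y∈) = trans (cong₂ (lcsℕ (e ∷ ws)) (update-at f t (suc e)) (old y∈))
      (trans (lcsℕ-sym (e ∷ ws) (suc e) (f y)) (trans (to-next y∈) (adj-sym (G * t) y t)))
    agrees′ {x} {y} (there x∈) (there y∈) = trans (cong₂ (lcsℕ (e ∷ ws)) (old x∈) (old y∈))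
      (trans (cong (λ i → lcsℕ (i ∷ ws) (f x) (f y)) (sym f-t)) (complement (here refl) (there x∈) (there y∈)))
    inj′ : ∀ {x y} → x ∈ t ∷ l → y ∈ t ∷ l → (f [ t ↦ suc e ]) x ≡ (f [ t ↦ suc e ]) y → x ≡ y
    inj′ (here refl) (here refl) p = refl
    inj′ (here refl) (there y∈)  p = contradiction (trans (sym (old y∈)) (trans (sym p) (update-at f t (suc e))))
      (ℕ.<⇒≢ (ℕ.m≤n⇒m≤1+n (proj₂ (f-l y∈))))
    inj′ (there x∈)  (here refl) p = contradiction (trans (sym (old x∈)) (trans p (update-at f t (suc e))))
      (ℕ.<⇒≢ (ℕ.m≤n⇒m≤1+n (proj₂ (f-l x∈))))
    inj′ (there x∈)  (there y∈)  p = inj (there x∈) (there y∈) (trans (sym (old x∈)) (trans p (old y∈)))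
    intact′ : ∀ {i j} → suc e ≤ i → suc e ≤ j → lcsℕ (e ∷ ws) i j ≡ pathℕ i j
    intact′ {i} {j} e<i e<j with ℕ.m≤n⇒m<n∨m≡n e<i | ℕ.m≤n⇒m<n∨m≡n e<j
    ... | inj₁ <i | _ = trans (cong (λ b → lcsℕ ws i j xor (b ∧ lcsℕ ws j e ∧ not (i ≡ᵇ j)))
      (trans (lcsℕ-sym ws i e) (trans (intact ℕ.≤-refl (ℕ.<⇒≤ e<i)) (path-far <i)))) (trans (Bool.xor-identityʳ _) (intact (ℕ.<⇒≤ e<i) (ℕ.<⇒≤ e<j)))
    ... | inj₂ refl | inj₂ refl = trans (lcsℕ-irrefl (e ∷ ws) (suc e)) (sym (lcsℕ-irrefl [] (suc e)))
    ... | inj₂ refl | inj₁ <j = trans (cong (λ b → lcsℕ ws i j xor (lcsℕ ws i e ∧ b ∧ not (i ≡ᵇ j)))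
      (trans (lcsℕ-sym ws j e) (trans (intact ℕ.≤-refl (ℕ.<⇒≤ e<j)) (path-far <j))))
      (trans (cong (lcsℕ ws i j xor_) (Bool.∧-zeroʳ _)) (trans (Bool.xor-identityʳ _) (intact (ℕ.<⇒≤ e<i) (ℕ.<⇒≤ e<j))))

  Realized-lc : ∀ {w} → w ∈ t ∷ l → Realized c (G * w) t l
  Realized-lc (here refl) = Realized-lc-last
  Realized-lc (there w∈)  = Realized-lc-inner w∈

  -- The new last vertex x is placed at e + 1 or, if it is isolated so far, at e + 2.
  Realized-extend : ∀ {x} → x ∉ t ∷ l → (∀ {y} → y ∈ l → adj G x y ≡ false) → Realized c G x (t ∷ l)
  Realized-extend {x} x∉ x-l with place
    where
    place : ∃ λ k → e < k × pathℕ k e ≡ adj G x t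
    place with dichotomy (adj G x t)
    ... | inj₁ p = suc e , ℕ.≤-refl , trans (Bool.∨-comm (suc (suc e) ≡ᵇ e) _) (trans (path-next e) (sym p))
    ... | inj₂ p = suc (suc e) , ℕ.m≤n+m _ 1 , trans (Bool.∨-comm (suc (suc (suc e)) ≡ᵇ e) _) (trans (path-far {e} ℕ.≤-refl) (sym p))
  ... | k , e<k , link = record
    { e = k ; ws = ws ; f = f [ x ↦ k ] ; f-t = update-at f x k ; c≤e = ℕ.≤-trans c≤e (ℕ.<⇒≤ e<k)
    ; f-l = λ y∈ → subst (λ i → c ≤ i × i < k) (sym (old y∈)) (low y∈ , ℕ.≤-<-trans (f≤e y∈) e<k)
    ; c≤ws = c≤ws ; agrees = agrees′ ; inj = inj′
    ; unattached = λ {y} {j} y∈ k<j → trans (cong (λ i → lcsℕ ws i j) (old y∈)) (unattached′ y∈ k<j)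
    ; intact = λ k≤i k≤j → intact (ℕ.≤-trans (ℕ.<⇒≤ e<k) k≤i) (ℕ.≤-trans (ℕ.<⇒≤ e<k) k≤j) }
    where
    old : ∀ {y} → y ∈ t ∷ l → (f [ x ↦ k ]) y ≡ f y
    old y∈ = update-off f k λ { refl → x∉ y∈ }
    low : ∀ {y} → y ∈ t ∷ l → c ≤ f y
    low (here refl) = subst (c ≤_) (sym f-t) c≤e
    low (there y∈)  = proj₁ (f-l y∈)
    unattached′ : ∀ {y j} → y ∈ t ∷ l → k < j → lcsℕ ws (f y) j ≡ false
    unattached′ {j = j} (here refl) k<j = trans (cong (λ i → lcsℕ ws i j) f-t)
      (trans (intact ℕ.≤-refl (ℕ.<⇒≤ (ℕ.<-trans e<k k<j))) (path-far (ℕ.≤-<-trans e<k k<j)))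
    unattached′ (there y∈) k<j = unattached y∈ (ℕ.<-trans e<k k<j)
    new : ∀ {y} → y ∈ t ∷ l → lcsℕ ws k (f y) ≡ adj G x y
    new (here refl) = trans (cong (lcsℕ ws k) f-t) (trans (intact (ℕ.<⇒≤ e<k) ℕ.≤-refl) link)
    new {y} (there y∈) = trans (lcsℕ-sym ws k (f y)) (trans (unattached y∈ e<k) (sym (x-l y∈)))
    agrees′ : ∀ {y z} → y ∈ x ∷ t ∷ l → z ∈ x ∷ t ∷ l → lcsℕ ws ((f [ x ↦ k ]) y) ((f [ x ↦ k ]) z) ≡ adj G y z
    agrees′ (here refl) (here refl) = trans (lcsℕ-irrefl ws _) (sym (adj-irrefl G x))
    agrees′ (here refl) (there z∈) = trans (cong₂ (lcsℕ ws) (update-at f x k) (old z∈)) (new z∈)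
    agrees′ {y} (there y∈) (here refl) = trans (cong₂ (lcsℕ ws) (old y∈) (update-at f x k))
      (trans (lcsℕ-sym ws (f y) k) (trans (new y∈) (adj-sym G x y)))
    agrees′ (there y∈) (there z∈) = trans (cong₂ (lcsℕ ws) (old y∈) (old z∈)) (agrees y∈ z∈)
    inj′ : ∀ {y z} → y ∈ x ∷ t ∷ l → z ∈ x ∷ t ∷ l → (f [ x ↦ k ]) y ≡ (f [ x ↦ k ]) z → y ≡ z
    inj′ (here refl) (here refl) p = refl
    inj′ (here refl) (there z∈) p = contradiction (trans (sym (old z∈)) (trans (sym p) (update-at f x k))) (ℕ.<⇒≢ (ℕ.≤-<-trans (f≤e z∈) e<k))
    inj′ (there y∈) (here refl) p = contradiction (trans (sym (old y∈)) (trans p (update-at f x k))) (ℕ.<⇒≢ (ℕ.≤-<-trans (f≤e y∈) e<k))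
    inj′ (there y∈) (there z∈) p = inj y∈ z∈ (trans (sym (old y∈)) (trans p (old z∈)))

-- An isolated vertex is placed in front of everything else, at c.
Realized-isolated : ∀ {c} {G : Graph n} {t l x} → Realized (2 + c) G t l → x ∉ t ∷ l →
  (∀ {y} → y ∈ t ∷ l → adj G x y ≡ false) → Realized c G t (x ∷ l)
Realized-isolated {c = c} {G} {t} {l} {x} r x∉ x-0 = record
  { e = e ; ws = ws ; f = f [ x ↦ c ] ; f-t = trans (old (here refl)) f-t ; c≤e = ℕ.≤-trans (ℕ.m≤n+m c 2) c≤e
  ; f-l = λ { (here refl) → subst (λ i → c ≤ i × i < e) (sym (update-at f x c)) (ℕ.≤-refl , ℕ.<-≤-trans (ℕ.m≤n+m _ 1) c≤e)
            ; (there y∈) → subst (λ i → c ≤ i × i < e) (sym (old (there y∈))) (ℕ.≤-trans (ℕ.m≤n+m c 2) (proj₁ (f-l y∈)) , proj₂ (f-l y∈)) }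
  ; c≤ws = All.map (ℕ.≤-trans (ℕ.m≤n+m c 2)) c≤ws ; agrees = λ y∈ z∈ → agrees′ (sort y∈) (sort z∈) ; inj = λ y∈ z∈ → inj′ (sort y∈) (sort z∈)
  ; unattached = λ { {j = j} (here refl) e<j → trans (cong (λ i → lcsℕ ws i j) (update-at f x c))
                 (trans (lcsℕ-before ws c≤ws j) (path-far (ℕ.<-trans c≤e e<j)))
             ; {j = j} (there y∈) e<j → trans (cong (λ i → lcsℕ ws i j) (old (there y∈))) (unattached y∈ e<j) }
  ; intact = intact }
  where
  open Realized r
  old : ∀ {y} → y ∈ t ∷ l → (f [ x ↦ c ]) y ≡ f y
  old y∈ = update-off f c λ { refl → x∉ y∈ }
  high : ∀ {y} → y ∈ t ∷ l → 2 + c ≤ f y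
  high (here refl) = subst (2 + c ≤_) (sym f-t) c≤e
  high (there y∈)  = proj₁ (f-l y∈)
  sort : ∀ {y} → y ∈ t ∷ x ∷ l → y ∈ x ∷ t ∷ l
  sort (here e)          = there (here e)
  sort (there (here e))  = here e
  sort (there (there p)) = there (there p)
  -- The positions used so far start at `2 + c`, so `c` is adjacent to none of them.
  new : ∀ {y} → y ∈ t ∷ l → lcsℕ ws c (f y) ≡ adj G x y
  new y∈ = trans (lcsℕ-before ws c≤ws _) (trans (path-far (high y∈)) (sym (x-0 y∈)))
  agrees′ : ∀ {y z} → y ∈ x ∷ t ∷ l → z ∈ x ∷ t ∷ l → lcsℕ ws ((f [ x ↦ c ]) y) ((f [ x ↦ c ]) z) ≡ adj G y z
  agrees′ (here refl) (here refl) = trans (lcsℕ-irrefl ws _) (sym (adj-irrefl G x))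
  agrees′ (here refl) (there z∈) = trans (cong₂ (lcsℕ ws) (update-at f x c) (old z∈)) (new z∈)
  agrees′ {y} (there y∈) (here refl) = trans (cong₂ (lcsℕ ws) (old y∈) (update-at f x c))
    (trans (lcsℕ-sym ws (f y) c) (trans (new y∈) (adj-sym G x y)))
  agrees′ (there y∈) (there z∈) = trans (cong₂ (lcsℕ ws) (old y∈) (old z∈)) (agrees y∈ z∈)
  inj′ : ∀ {y z} → y ∈ x ∷ t ∷ l → z ∈ x ∷ t ∷ l → (f [ x ↦ c ]) y ≡ (f [ x ↦ c ]) z → y ≡ z
  inj′ (here refl) (here refl) p = refl
  inj′ (here refl) (there z∈) p = contradiction (trans (sym (update-at f x c)) (trans p (old z∈))) (ℕ.<⇒≢ (ℕ.<-≤-trans (ℕ.m≤n+m _ 1) (high z∈)))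
  inj′ (there y∈) (here refl) p = contradiction (trans (sym (update-at f x c)) (trans (sym p) (old y∈))) (ℕ.<⇒≢ (ℕ.<-≤-trans (ℕ.m≤n+m _ 1) (high y∈)))
  inj′ (there y∈) (there z∈) p = inj y∈ z∈ (trans (sym (old y∈)) (trans p (old z∈)))

Realized-unlc : ∀ {c} {G : Graph n} {t l w} → Unique (t ∷ l) → w ∈ t ∷ l → Realized c (G * w) t l → Realized c G t l
Realized-unlc {G = G} {w = w} u w∈ r = Realized-cong (lc-involutive G w) (Realized-lc u r w∈)

-- Quantified over `c`, since adding an isolated vertex asks for a realization of the rest that
-- starts two positions later.
Realizable : Graph n → Fin n → List (Fin n) → Set
Realizable G t l = ∀ c → Realized c G t l

module _ {u t : Fin n} {l : List (Fin n)} (uq : Unique (u ∷ t ∷ l))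
  (rec-t : ∀ {G} → Lin G (t ∷ l) → Realizable G t l) (rec-u : ∀ {G} → Lin G (u ∷ l) → Realizable G u l) where

  private
    u∉ : u ∉ t ∷ l
    u∉ p = All.lookup (AllPairs.head uq) p refl
    u∉l : u ∉ l
    u∉l = u∉ ∘ there
    t∉l : t ∉ l
    t∉l p = All.lookup (AllPairs.head (AllPairs.tail uq)) p refl
    without-u : ∀ {G : Graph n} → Lin G (u ∷ t ∷ l) → Lin G (t ∷ l)
    without-u {G} = Lin-⊆ {G = G} (u ∷ʳ ⊆-refl)
    without-t : ∀ {G : Graph n} → Lin G (u ∷ t ∷ l) → Lin G (u ∷ l)
    without-t {G} = Lin-⊆ {G = G} (refl Sublist.∷ (t ∷ʳ ⊆-refl))

  realize-next : ∀ {G} → Lin G (u ∷ t ∷ l) → (∀ {y} → y ∈ l → adj G u y ≡ false) → Realizable G u (t ∷ l)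
  realize-next {G} lin u-l c = Realized-extend (AllPairs.tail uq) (rec-t (without-u {G} lin) c) u∉ u-l

  realize-true-twin : ∀ {G} → Lin G (u ∷ t ∷ l) → adj G u t ≡ true → (∀ {y} → y ∈ l → adj G u y ≡ adj G t y) →
    Realizable G u (t ∷ l)
  realize-true-twin {G} lin ut e c = Realized-unlc uq (there (here refl))
    (realize-next (Lin-lc {G = G} uq (there (here refl)) lin) (true-twin→pendant G u∉l t∉l ut e) c)

  realize-pendant : ∀ {G} → Lin G (u ∷ t ∷ l) → adj G u t ≡ true → (∀ {y} → y ∈ l → adj G t y ≡ false) →
    Realizable G u (t ∷ l)
  realize-pendant {G} lin ut z c = Realized-unlc uq (here refl)
    (realize-true-twin (Lin-lc {G = G} uq (here refl) lin) (trans (lc-centreˡ G u t) ut) (pendant→true-twin G u∉l t∉l ut z) c)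

  -- The rows of `u` and `t` on `l` are dependent. If row `u` vanishes, `u` extends the path; twins
  -- and a pendant `t` are reduced to this by complementations. Only an isolated `t` needs the
  -- realization of `u ∷ l`.
  realize-step : ∀ {G} → Lin G (u ∷ t ∷ l) → Realizable G u (t ∷ l)
  realize-step {G} lin c with Lin-parallel {G = G} lin | dichotomy (adj G u t)
  ... | zeroˡ z | _ = realize-next lin z c
  ... | zeroʳ z | inj₁ ut = realize-pendant lin ut z c
  ... | zeroʳ z | inj₂ ut = Realized-isolated (rec-u (without-t {G} lin) (2 + c)) t∉
      λ { (here refl) → trans (adj-sym G t u) ut ; (there y∈) → z y∈ }
    where
    t∉ : t ∉ u ∷ l
    t∉ (here e)   = u∉ (here (sym e))
    t∉ (there p) = t∉l p
  ... | equal _ _ e  | inj₁ ut = realize-true-twin lin ut e c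
  ... | equal {z} z∈ uz e | inj₂ ut with false-twin→true-twin G {R = l} u∉l t∉l z∈ uz (u∉ ∘ here) ut e
  ... | ut′ , e′ = Realized-unlc uq (there (there z∈)) (realize-true-twin (Lin-lc {G = G} uq (there (there z∈)) lin) ut′ e′ c)

realize : (l : List (Fin n)) {t : Fin n} → Unique (t ∷ l) → {G : Graph n} → Lin G (t ∷ l) → Realizable G t l
realize [] {t} uq {G} lin c = record
  { e = c ; ws = [] ; f = λ _ → c ; f-t = refl ; c≤e = ℕ.≤-refl ; f-l = λ () ; c≤ws = []
  ; agrees = λ { (here refl) (here refl) → trans (lcsℕ-irrefl [] c) (sym (adj-irrefl G t)) }
  ; inj = λ { (here refl) (here refl) _ → refl } ; unattached = λ () ; intact = λ _ _ → refl }
realize (t ∷ l) {u} uq@((_ ∷ u≢) ∷ uq′) lin = realize-step uq (realize l uq′) (realize l (u≢ ∷ AllPairs.tail uq′)) lin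

-- From realizations to vertex-minors of finite paths

path-centres : ∀ {k} (ws : List ℕ) → All (_< k) ws →
  ∃ λ ws′ → ∀ i j → adj (lcs (Path k) ws′) i j ≡ lcsℕ ws (toℕ i) (toℕ j)
path-centres [] [] = [] , λ i j → refl
path-centres {k} (w ∷ ws) (w<k ∷ ws<k) with path-centres ws ws<k
-- The head of the list is the last centre applied by `lcsℕ` but the first applied by `lcs`, so it
-- goes to the end.
... | ws′ , e = ws′ ++ w′ ∷ [] , λ i j → trans
  (cong (λ G → adj G i j) (List.foldl-∷ʳ _*_ (Path k) w′ ws′))
  (trans (cong₂ _xor_ (e i j) (cong₂ (λ a b → a ∧ b ∧ not (i =ᶠ j)) (e i w′) (e j w′)))
    (cong (λ v → lcℕ (lcsℕ ws) v (toℕ i) (toℕ j)) (Fin.toℕ-fromℕ< w<k)))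
  where
  w′ : Fin k
  w′ = fromℕ< w<k

Realized⇒VM : ∀ {n c} {G : Graph n} {t l} → (∀ x → x ∈ t ∷ l) → Realized c G t l → ∃ λ k → VM (Path k) G
Realized⇒VM {n} {G = G} every r with bounded f | bounded (lookup ws)
  where open Realized r
... | b , f<b | b′ , ws<b′ with path-centres {b + b′} (Realized.ws r)
    (All.tabulate λ {w} w∈ → subst (_< b + b′) (sym (Any.lookup-index w∈)) (ℕ.<-≤-trans (ws<b′ (index w∈)) (ℕ.m≤n+m b′ b)))
-- `b` bounds the positions of the vertices and `b′` the centres, so a path on `b + b′` vertices
-- contains both.
... | ws′ , eq = b + b′ , vm ws′ g (λ {i} {j} p → inj (every i) (every j) (trans (sym (toℕ-g i)) (trans (cong toℕ p) (toℕ-g j))))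
  λ i j → trans (sym (agrees (every i) (every j))) (trans (sym (cong₂ (lcsℕ ws) (toℕ-g i) (toℕ-g j))) (sym (eq (g i) (g j))))
  where
  open Realized r
  f<k : ∀ i → f i < b + b′
  f<k i = ℕ.<-≤-trans (f<b i) (ℕ.m≤m+n b b′)
  g : Fin n → Fin (b + b′)
  g i = fromℕ< (f<k i)
  toℕ-g : ∀ i → toℕ (g i) ≡ f i
  toℕ-g i = Fin.toℕ-fromℕ< (f<k i)

Lin⇒path-minor : ∀ {n} {G : Graph n} (zs : List (Fin n)) → zs ↭ allFin n → Lin G zs → ∃[ k ] HasVertexMinor (Path k) G
Lin⇒path-minor {n} {G} [] perm lin = 0 , VM⇒HasVertexMinor {G = Path 0} {G} (vm [] (⊥-elim ∘ none) (λ {i} _ → ⊥-elim (none i)) (λ i → ⊥-elim (none i)))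
  where
  none : Fin n → ⊥
  none i with Perm.∈-resp-↭ (↭-sym perm) (∈-allFin i)
  ... | ()
Lin⇒path-minor {n} {G} (t ∷ l) perm lin
  with Realized⇒VM (λ x → Perm.∈-resp-↭ (↭-sym perm) (∈-allFin x))
    (realize l (Unique-resp-↭ (↭-sym perm) (Unique.allFin⁺ n)) {G} lin 0)
... | k , minor = k , VM⇒HasVertexMinor {G = Path k} {G} minor

-- The implications between the three conditions

Excluded⇒Layout : ∀ {n} {G : Graph n} → Excluded G → Layout G (allFin n)
Excluded⇒Layout {n} {G} (¬C5 , ¬N , ¬Q) with layout G _ (allFin n) refl (Unique.allFin⁺ n)
... | inj₁ l = l
... | inj₂ (inj₁ o) = contradiction (VM⇒HasVertexMinor {G = G} o) ¬C5
... | inj₂ (inj₂ (inj₁ o)) = contradiction (VM⇒HasVertexMinor {G = G} o) ¬N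
... | inj₂ (inj₂ (inj₂ o)) = contradiction (VM⇒HasVertexMinor {G = G} o) ¬Q

LinRankWidth≤1⇒Excluded : ∀ {n} {G : Graph n} → LinRankWidth≤ G 1 → Excluded G
LinRankWidth≤1⇒Excluded {n} {G} (inj₁ n≤1) =
  -- With at most one vertex every minor has two equal rows, so the positions `toℕ` serve.
  Ordered⇒Excluded {G = G} {toℕ} Fin.toℕ-injective λ j {x} {x′} sx sx′ ty ty′ → trivial x x′
  where
  trivial : ∀ x x′ {y y′} → adj G x y ∧ adj G x′ y′ ≡ adj G x y′ ∧ adj G x′ y
  trivial x x′ {y} with Fin.toℕ-injective {i = x} {x′} (trans (at-0 x) (sym (at-0 x′)))
    where
    at-0 : ∀ (x : Fin n) → toℕ x ≡ 0
    at-0 x = ℕ.n<1⇒n≡0 (ℕ.<-≤-trans (Fin.toℕ<n x) n≤1)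
  ... | refl = Bool.∧-comm (adj G x y) _
LinRankWidth≤1⇒Excluded {G = G} (inj₂ (_ , σ , width)) = Ordered⇒Excluded {G = G} {toℕ ∘ Inverse.from σ}
  (λ p → trans (sym (Inverse.strictlyInverseˡ σ _)) (trans (cong (Inverse.to σ) (Fin.toℕ-injective p)) (Inverse.strictlyInverseˡ σ _)))
  (DecompWidth⇒Ordered {G = G} σ width)

path-minor⇒Excluded : ∀ {n} {G : Graph n} → ∃[ k ] HasVertexMinor (Path k) G → Excluded G
path-minor⇒Excluded {G = G} (k , minor) with HasVertexMinor⇒VM minor
... | m = Ordered⇒Excluded {G = G} {toℕ ∘ VM.embed m} (VM.injective m ∘ Fin.toℕ-injective) (Ordered-VM {G = Path k} {G} (Path-Ordered k) m)

theorem4p3 : ∀ {n : ℕ} (G : Graph n) →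
    (LinRankWidth≤ G 1 ⇔ (¬ HasVertexMinor G C5 × ¬ HasVertexMinor G N × ¬ HasVertexMinor G Q)) ×
    ((¬ HasVertexMinor G C5 × ¬ HasVertexMinor G N × ¬ HasVertexMinor G Q) ⇔ (∃[ k ] HasVertexMinor (Path k) G))
theorem4p3 G =
  mk⇔ (LinRankWidth≤1⇒Excluded {G = G})
    (λ ex → let zs , perm , lin = Excluded⇒Layout {G = G} ex in Lin⇒LinRankWidth≤1 G zs perm lin) ,
  mk⇔ (λ ex → let zs , perm , lin = Excluded⇒Layout {G = G} ex in Lin⇒path-minor {G = G} zs perm lin)
    (path-minor⇒Excluded {G = G})
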